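{- For an arbitrary snark $G$, the following statements are equivalent: (i) $G$ is critical; (ii) $G$ is $4$-edge-critical; (iii) $G$ is $5$-irreducible; (iv) $G$ is $6$-irreducible; (v) $G\sim e$ is $3$-edge-colourable for each edge $e$ of $G$.
   Context: Graphs may have parallel edges and loops. A snark is a connected cubic graph that admits no proper edge-colouring with three colours (equivalently, no nowhere-zero $4$-flow). For distinct vertices $u,v$ of $G$, $G-\{u,v\}$ denotes the graph obtained by removing $u$ and $v$ but retaining the edges formerly incident with them as dangling edges, and $G/\{u,v\}$ denotes the graph obtained by identifying $u$ and $v$. For an edge $e$, $G\sim e$ denotes the cubic graph obtained from $G-e$ (deletion of $e$) by suppressing the two resulting vertices of degree two. A snark $G$ is critical if $G-\{u,v\}$ is $3$-edge-colourable for every pair of adjacent vertices $u,v$. A snark $G$ is $4$-edge-critical if $G/\{u,v\}$ admits a nowhere-zero $4$-flow for every pair of adjacent vertices $u,v$ (equivalently, $G/e$ has a nowhere-zero $4$-flow for every edge $e$, since loops do not affect existence of nowhere-zero flows). For an integer $k\ge1$, a snark $G$ is $k$-irreducible if removing fewer than $k$ edges from $G$ never produces a component of chromatic index $4$ that can be completed (by adding vertices and edges) to a cubic graph $H$ with fewer vertices than $G$. -}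

module Defs where

open import Data.Nat using (ℕ; zero; suc; pred; _<_)
open import Data.Fin using (Fin; zero; suc; punchOut; punchIn; opposite; _≟_)
open import Data.Fin.Subset using (Subset; _∈_; _∉_; ∣_∣)
open import Data.Maybe using (Maybe; just; nothing; _>>=_)
import Data.Maybe as Maybe
import Data.Maybe.Properties as MaybeP
open import Data.List using (List; []; _∷_; allFin; map; foldr; concatMap)
open import Data.Nat.ListAction using (sum)
open import Data.Integer as ℤ using (ℤ; +_; _-_; _*_)
open import Data.Product using (Σ; ∃; ∃-syntax; _×_; _,_)
open import Data.Sum using (_⊎_)
open import Data.Bool using (Bool; true; false; if_then_else_; _∧_)
open import Data.Empty using (⊥)
open import Relation.Nullary using (¬_; yes; no)
open import Relation.Nullary.Decidable using (⌊_⌋)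
open import Relation.Binary.PropositionalEquality using (_≡_; _≢_; refl; sym)
open import Relation.Binary.Construct.Closure.ReflexiveTransitive using (Star)
open import Function using (_∘_; _⇔_)
open import Function.Definitions using (Injective)

-- Multigraphs (parallel edges and loops allowed) with possibly dangling
-- edges.  Vertices are Fin n, edges are Fin (nE G); every edge has two
-- ends (indexed by Fin 2); an end is either a vertex ('just v') or
-- dangling ('nothing').  A loop at v is an edge with both ends 'just v'.
-- The order of the two ends serves as a reference orientation (end 0 =
-- tail, end 1 = head), used only for defining integer flows.

record Graph (n : ℕ) : Set where
  field
    nE   : ℕ
    ends : Fin nE → Fin 2 → Maybe (Fin n)
open Graph public

Adj : ∀ {n} → Graph n → Fin n → Fin n → Set
Adj G u v = ∃[ e ] ((ends G e zero ≡ just u × ends G e (suc zero) ≡ just v)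
                 ⊎ (ends G e zero ≡ just v × ends G e (suc zero) ≡ just u))

Connected : ∀ {n} → Graph n → Set
Connected {n} G = ∀ (u v : Fin n) → Star (Adj G) u v

atN : ∀ {n} → Maybe (Fin n) → Fin n → ℕ
atN nothing  v = 0
atN (just w) v = if ⌊ w ≟ v ⌋ then 1 else 0

-- degree (a loop counts twice)
deg : ∀ {n} → Graph n → Fin n → ℕ
deg G v = sum (map (λ e → sum (map (λ i → atN (ends G e i) v) (allFin 2))) (allFin (nE G)))

Cubic : ∀ {n} → Graph n → Set
Cubic {n} G = (∀ e i → ends G e i ≢ nothing) × (∀ (v : Fin n) → deg G v ≡ 3)

-- proper 3-edge-colouring: any two distinct edge-ends at a common vertex
-- carry different colours (so a graph with a loop is never colourable);
-- dangling ends impose no condition.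
Colourable3 : ∀ {n} → Graph n → Set
Colourable3 G = Σ (Fin (nE G) → Fin 3) λ c → (∀ e e' i i' v → ends G e i ≡ just v → ends G e' i' ≡ just v
                          → (e , i) ≢ (e' , i') → c e ≢ c e')

sumℤ : List ℤ → ℤ
sumℤ = foldr ℤ._+_ (+ 0)

atZ : ∀ {n} → Maybe (Fin n) → Fin n → ℤ
atZ m v = + atN m v

netFlow : ∀ {n} (G : Graph n) → (Fin (nE G) → ℤ) → Fin n → ℤ
netFlow G f v = sumℤ (map (λ e → (atZ (ends G e (suc zero)) v - atZ (ends G e zero) v) * f e)
                          (allFin (nE G)))

NZ4Flow : ∀ {n} → Graph n → Set
NZ4Flow {n} G = ∃[ f ] ((∀ e → 0 < ℤ.∣ f e ∣ × ℤ.∣ f e ∣ < 4) × (∀ (v : Fin n) → netFlow G f v ≡ + 0))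

Snark : ∀ {n} → Graph n → Set
Snark G = Connected G × Cubic G × ¬ Colourable3 G

mapV : ∀ {n k} → (Fin n → Maybe (Fin k)) → Graph n → Graph k
mapV f G = record { nE = nE G ; ends = λ e i → ends G e i >>= f }

removeV : ∀ {n} → Fin n → Fin n → Maybe (Fin (pred n))
removeV {suc m} x w with w ≟ x
... | yes _ = nothing
... | no p  = just (punchOut {i = x} {j = w} (p ∘ sym))

-- delete a vertex; its incident edges are kept, with dangling ends there
deleteVertex : ∀ {n} → Graph n → Fin n → Graph (pred n)
deleteVertex G x = mapV (removeV x) G

deletePair : ∀ {n} (G : Graph n) (u v : Fin n) → u ≢ v → Graph (pred (pred n))
deletePair {suc m} G u v p = deleteVertex (deleteVertex G u) (punchOut {i = u} {j = v} p)

mergeV : ∀ {m} (u v : Fin (suc m)) → u ≢ v → Fin (suc m) → Fin m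
mergeV u v p w with w ≟ u
... | yes _ = punchOut {i = u} {j = v} p
... | no q  = punchOut {i = u} {j = w} (q ∘ sym)

identify : ∀ {n} (G : Graph n) (u v : Fin n) → u ≢ v → Graph (pred n)
identify {suc m} G u v p = mapV (just ∘ mergeV u v p) G

delEnds : ∀ {n m} → (Fin m → Fin 2 → Maybe (Fin n)) → Fin m → Fin (pred m) → Fin 2 → Maybe (Fin n)
delEnds {m = suc m} en e e' = en (punchIn e e')

deleteEdge : ∀ {n} (G : Graph n) → Fin (nE G) → Graph n
deleteEdge G e = record { nE = pred (nE G) ; ends = delEnds (ends G) e }

endsAt : ∀ {n} (G : Graph n) → Fin n → List (Fin (nE G) × Fin 2)
endsAt G x = concatMap (λ e → concatMap (λ i → if ⌊ MaybeP.≡-dec _≟_ (ends G e i) (just x) ⌋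
                                                  then (e , i) ∷ [] else [])
                                        (allFin 2))
                       (allFin (nE G))

-- suppression of a vertex x of degree 2:
--  * if x carries a loop e (its only edge), x is removed and e becomes a
--    vertex-free circle (an edge with no vertex ends);
--  * otherwise, with edge-ends (e1,i1),(e2,i2) at x, the end i1 of e1 is
--    re-attached to the far end of e2, then e2 and x are removed.
-- (If x does not have degree 2 the result is irrelevant; we just delete x.)
suppress : ∀ {n} → Graph n → Fin n → Graph (pred n)
suppress G x with endsAt G x
... | (e1 , i1) ∷ (e2 , i2) ∷ [] with e1 ≟ e2
...   | yes _ = deleteVertex G x
...   | no _  = deleteEdge (deleteVertex G1 x) e2
  where
    G1 : Graph _
    G1 = record { nE = nE G
                ; ends = λ e i → if ⌊ e ≟ e1 ⌋ ∧ ⌊ i ≟ i1 ⌋ then ends G e2 (opposite i2) else ends G e i }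
suppress G x | _ = deleteVertex G x

smooth : ∀ {n} (G : Graph n) → Fin (nE G) → (x y : Fin n) → x ≢ y → Graph (pred (pred n))
smooth {suc m} G e x y p = suppress (suppress (deleteEdge G e) x) (punchOut {i = x} {j = y} p)

record Embedding {k n} (K : Graph k) (G : Graph n) : Set where
  field
    φV   : Fin k → Fin n
    φE   : Fin (nE K) → Fin (nE G)
    injV : Injective _≡_ _≡_ φV
    injE : Injective _≡_ _≡_ φE
    pres : ∀ e → (∀ i → ends G (φE e) i ≡ Maybe.map φV (ends K e i))
               ⊎ (∀ i → ends G (φE e) i ≡ Maybe.map φV (ends K e (opposite i)))
open Embedding public

IsComponentMinus : ∀ {n k} (G : Graph n) → Subset (nE G) → Graph k → Set
IsComponentMinus G S K =
  Σ (Embedding K G) λ φ →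
      Connected K
    × (∀ e → φE φ e ∉ S)
    × (∀ e i v → e ∉ S → ends G e i ≡ just (φV φ v) → ∃[ e' ] φE φ e' ≡ e)

Irreducible : ℕ → ∀ {n} → Graph n → Set
Irreducible k {n} G =
  ∀ (S : Subset (nE G)) → ∣ S ∣ < k →
  ∀ {j} (K : Graph j) → IsComponentMinus G S K → ¬ Colourable3 K →
  ¬ (Σ ℕ λ h → Σ (Graph h) λ H → Cubic H × h < n × Embedding K H)

Critical : ∀ {n} → Graph n → Set
Critical {n} G = ∀ (u v : Fin n) (p : u ≢ v) → Adj G u v → Colourable3 (deletePair G u v p)

FourEdgeCritical : ∀ {n} → Graph n → Set
FourEdgeCritical {n} G = ∀ (u v : Fin n) (p : u ≢ v) → Adj G u v → NZ4Flow (identify G u v p)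

SmoothColourable : ∀ {n} → Graph n → Set
SmoothColourable {n} G =
  ∀ (e : Fin (nE G)) (x y : Fin n) → ends G e zero ≡ just x → ends G e (suc zero) ≡ just y →
  (p : x ≢ y) → Colourable3 (smooth G e x y p)

{-# OPTIONS --safe #-}
-- Identify the three colours with the nonzero elements of the Klein four-group: a colouring is
-- proper at a cubic vertex iff the colours around it sum to zero.  By the handshake identity a
-- colouring of G − {u,v} has equal colour sums at u and v.
--
-- (i) ⇔ (ii): a colouring of G − {u,v} is a nowhere-zero Klein flow on G/{u,v}.  Each of its two
-- coordinates is an even subgraph, which Eulerian orientation turns into circulations f₁ and f₂
-- with values 0, ±1, and f₁ + 2f₂ is a nowhere-zero 4-flow.  Conversely, if f is such a flow and
-- g orients its odd edges, then f and (f + g)/2 modulo 2 are the two coordinates of a Klein flow.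
--
-- (i) ⇔ (v): if the two further edges at u had different colours, then their sum would colour uv
-- and complete a colouring of the snark; hence they agree at u, and likewise at v, which is what a
-- colouring of G ∼ uv amounts to.
--
-- (i) ⇒ (iv): a component that is not colourable misses no two adjacent vertices, so with at most
-- five removed edges it misses only one vertex, and a smaller cubic completion would have odd order.
--
-- (iii) ⇒ (i): removing the four edges adjacent to uv isolates u and v from the rest.  Every other
-- component completes to a cubic graph with at most one extra vertex, hence is colourable, and the
-- four removed edges can be coloured greedily.
module Submission where

open import Defs
open import Algebra.Bundles using (CommutativeMonoid; CommutativeRing)
open import Data.Nat as ℕ using (ℕ; zero; suc; pred; _≤_; _<_; z≤n; s≤s)
import Data.Nat.Properties as ℕ
open import Data.Fin using (Fin; zero; suc; punchIn; punchOut; opposite; _≟_)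
open import Data.Fin.Properties using (punchInᵢ≢i; punchIn-injective; punchIn-punchOut; punchOut-punchIn; punchOut-cong; injective⇒≤; all?; any?; ¬∀⟶∃¬; opposite-involutive; suc-injective)
open import Data.Maybe as Maybe using (Maybe; just; nothing; _>>=_; fromMaybe)
open import Data.Maybe.Properties as MaybeP using (just-injective)
open import Data.List using (List; []; _∷_; _++_; allFin; map; foldr; concatMap; tabulate; length; filter; cartesianProduct; lookup)
open import Data.List.Properties using (filter-++)
open import Data.List.Membership.Propositional using () renaming (_∈_ to _∈ˡ_; _∉_ to _∉ˡ_)
open import Data.List.Membership.Propositional.Properties using (∈-filter⁺; ∈-filter⁻; ∈-cartesianProduct⁺; ∈-allFin; ∈-lookup)
open import Data.List.Relation.Unary.Any as Any using (here; there)
open import Data.List.Relation.Unary.Any.Properties using (lookup-index)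
open import Data.List.Relation.Unary.All as All using (All; []; _∷_)
open import Data.List.Relation.Unary.AllPairs using ([]; _∷_)
open import Data.List.Relation.Unary.Unique.Propositional using (Unique)
open import Data.List.Relation.Unary.Unique.Propositional.Properties using (filter⁺; cartesianProduct⁺; allFin⁺)
open import Data.Product using (Σ; ∃; ∃-syntax; _×_; _,_; proj₁; proj₂)
open import Data.Product.Properties using (≡-dec)
open import Data.Sum using (_⊎_; inj₁; inj₂; [_,_])
open import Data.Bool using (Bool; true; false; if_then_else_; _xor_; not; _∧_)
open import Data.Bool.Properties using (xor-∧-commutativeRing; xor-same; xor-comm; xor-assoc; xor-identityʳ; not-involutive) renaming (_≟_ to _≟ᵇ_)
open import Data.Empty using (⊥; ⊥-elim)
open import Level using (0ℓ)
open import Relation.Nullary using (¬_; Dec; yes; no; contradiction; does)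
open import Relation.Nullary.Decidable using (⌊_⌋; toWitness; ¬?; _→-dec_; _×-dec_; _⊎-dec_; decidable-stable; ¬¬-excluded-middle; map′; dec-true; dec-false)
open import Relation.Binary.PropositionalEquality hiding ([_])
open import Function using (_∘_; id; _⇔_; mk⇔)
open import Data.Integer as ℤ using (ℤ; +_; -[1+_]; 0ℤ; 1ℤ; -1ℤ)
import Data.Integer.Properties as ℤ
open import Data.Integer.Tactic.RingSolver using (solve-∀)
open import Data.Unit using (⊤; tt)
open import Data.Fin.Subset using (Subset; _∈_; _∉_; ∣_∣; ⁅_⁆; _∪_; inside; outside) renaming (⊥ to ∅)
open import Data.Fin.Subset.Properties using (_∈?_; x∈p∧x≢y⇒x∈p-y; x∈p⇒∣p-x∣<∣p∣; ∪-identityˡ; ∣p∣≤∣x∷p∣; ∣⊥∣≡0; ∉⊥; x∈⁅x⁆; x∈⁅y⁆⇒x≡y; x∈p∪q⁺; x∈p∪q⁻)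
open import Relation.Binary.Construct.Closure.ReflexiveTransitive using (Star; ε; _◅_; _◅◅_; reverse)
import Data.Nat.Tactic.RingSolver as ℕSolver
open import Data.Vec using ([]; _∷_)

-- Edge-ends and their incidence with vertices

End : ∀ {n} → Graph n → Set
End G = Fin (nE G) × Fin 2

At : ∀ {n} (G : Graph n) → End G → Fin n → Set
At G (e , i) v = ends G e i ≡ just v

at? : ∀ {n} (G : Graph n) (h : End G) (v : Fin n) → Dec (At G h v)
at? G (e , i) v = MaybeP.≡-dec _≟_ (ends G e i) (just v)

Closed : ∀ {n} → Graph n → Set
Closed G = ∀ e i → ends G e i ≢ nothing

endV : ∀ {n} (G : Graph n) → Closed G → ∀ e i → ∃[ v ] ends G e i ≡ just v
endV G cl e i with ends G e i in eq
... | just v  = v , refl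
... | nothing = ⊥-elim (cl e i eq)

At-unique : ∀ {n} (G : Graph n) h {v w} → At G h v → At G h w → v ≡ w
At-unique G h p q = just-injective (trans (sym p) q)

opp≢ : ∀ (i : Fin 2) → opposite i ≢ i
opp≢ zero       ()
opp≢ (suc zero) ()

≢⇒opp : ∀ {i j : Fin 2} → i ≢ j → j ≡ opposite i
≢⇒opp {zero}     {zero}     p = contradiction refl p
≢⇒opp {zero}     {suc zero} p = refl
≢⇒opp {suc zero} {zero}     p = refl
≢⇒opp {suc zero} {suc zero} p = contradiction refl p

-- In this form distinctness and membership of the listed ends follow from the general facts on
-- filters and cartesian products.
endsAt-filter : ∀ {n} (G : Graph n) v →
  endsAt G v ≡ filter (λ h → at? G h v) (cartesianProduct (allFin (nE G)) (allFin 2))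
endsAt-filter G v = outer (allFin (nE G))
  where
  P? = λ h → at? G h v
  inner : ∀ e is → concatMap (λ i → if ⌊ P? (e , i) ⌋ then (e , i) ∷ [] else []) is
                 ≡ filter P? (map (e ,_) is)
  inner e []       = refl
  inner e (i ∷ is) with P? (e , i)
  ... | yes _ = cong ((e , i) ∷_) (inner e is)
  ... | no _  = inner e is
  outer : ∀ es → concatMap (λ e → concatMap (λ i → if ⌊ P? (e , i) ⌋ then (e , i) ∷ [] else []) (allFin 2)) es
               ≡ filter P? (cartesianProduct es (allFin 2))
  outer []       = refl
  outer (e ∷ es) = trans (cong₂ _++_ (inner e (allFin 2)) (outer es))
                         (sym (filter-++ P? (map (e ,_) (allFin 2)) _))

endsAt-unique : ∀ {n} (G : Graph n) v → Unique (endsAt G v)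
endsAt-unique G v rewrite endsAt-filter G v =
  filter⁺ (λ h → at? G h v) (cartesianProduct⁺ (allFin⁺ (nE G)) (allFin⁺ 2))

∈-endsAt⁺ : ∀ {n} (G : Graph n) {v} h → At G h v → h ∈ˡ endsAt G v
∈-endsAt⁺ G {v} (e , i) p rewrite endsAt-filter G v =
  ∈-filter⁺ (λ h → at? G h v) (∈-cartesianProduct⁺ (∈-allFin e) (∈-allFin i)) p

∈-endsAt⁻ : ∀ {n} (G : Graph n) {v} {h} → h ∈ˡ endsAt G v → At G h v
∈-endsAt⁻ G {v} p rewrite endsAt-filter G v =
  proj₂ (∈-filter⁻ (λ h → at? G h v) {xs = cartesianProduct (allFin (nE G)) (allFin 2)} p)

unique-lookup-injective : ∀ {A : Set} {xs : List A} → Unique xs →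
  ∀ {i j} → lookup xs i ≡ lookup xs j → i ≡ j
unique-lookup-injective (x∉ ∷ u) {zero}  {zero}  eq = refl
unique-lookup-injective {xs = _ ∷ xs} (x∉ ∷ u) {zero}  {suc j} eq =
  contradiction eq (All.lookup x∉ (∈-lookup {xs = xs} j))
unique-lookup-injective {xs = _ ∷ xs} (x∉ ∷ u) {suc i} {zero}  eq =
  contradiction (sym eq) (All.lookup x∉ (∈-lookup {xs = xs} i))
unique-lookup-injective (x∉ ∷ u) {suc i} {suc j} eq = cong suc (unique-lookup-injective u eq)

-- Each position in `xs` is sent to a position of its image in `ys`, and this map is injective.
-- Injectivity of `f` is asked on members of `xs` only, so that maps well behaved just on the ends
-- at one vertex can compare degrees.
unique-length-≤ : ∀ {A B : Set} {xs : List A} {ys : List B} (f : A → B) → Unique xs →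
  (∀ {x} → x ∈ˡ xs → f x ∈ˡ ys) →
  (∀ {x y} → x ∈ˡ xs → y ∈ˡ xs → f x ≡ f y → x ≡ y) →
  length xs ≤ length ys
unique-length-≤ {xs = xs} {ys} f u sub inj = injective⇒≤ {f = pos} pos-injective
  where
  pos : Fin (length xs) → Fin (length ys)
  pos i = Any.index (sub (∈-lookup {xs = xs} i))
  pos-injective : ∀ {i j} → pos i ≡ pos j → i ≡ j
  pos-injective {i} {j} eq = unique-lookup-injective u
    (inj (∈-lookup {xs = xs} i) (∈-lookup {xs = xs} j)
      (trans (lookup-index (sub (∈-lookup {xs = xs} i)))
        (trans (cong (lookup ys) eq) (sym (lookup-index (sub (∈-lookup {xs = xs} j)))))))

-- Sums over edge-ends and the handshake identity

module EndSum (M : CommutativeMonoid 0ℓ 0ℓ) where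
  open CommutativeMonoid M
    using (Carrier; _≈_; _∙_; ∙-cong; ∙-congˡ; identityˡ; identityʳ; assoc)
    renaming (ε to 0#; refl to ≈-refl; sym to ≈-sym; trans to ≈-trans; reflexive to ≈-reflexive)
  open import Algebra.Properties.CommutativeMonoid.Sum M public

  pick : ∀ {n} → Maybe (Fin n) → Fin n → Carrier → Carrier
  pick nothing  v a = 0#
  pick (just w) v a = if ⌊ w ≟ v ⌋ then a else 0#

  pick-at : ∀ {n} {m : Maybe (Fin n)} {v} a → m ≡ just v → pick m v a ≡ a
  pick-at {v = v} a refl with v ≟ v
  ... | yes _ = refl
  ... | no q  = contradiction refl q

  pick-off : ∀ {n} {m : Maybe (Fin n)} {v} a → m ≢ just v → pick m v a ≡ 0#
  pick-off {m = nothing} a p = refl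
  pick-off {m = just w} {v} a p with w ≟ v
  ... | yes refl = contradiction refl p
  ... | no _     = refl

  pick-≗ : ∀ {n k} {m : Maybe (Fin n)} {v} {m′ : Maybe (Fin k)} {v′} a →
    (m ≡ just v → m′ ≡ just v′) → (m′ ≡ just v′ → m ≡ just v) → pick m v a ≡ pick m′ v′ a
  pick-≗ {m = m} {v} a f g with MaybeP.≡-dec _≟_ m (just v)
  ... | yes p = trans (pick-at a p) (sym (pick-at a (f p)))
  ... | no p  = trans (pick-off a p) (sym (pick-off a (p ∘ g)))

  -- Over the naturals with constant value 1 this is the degree; over the Booleans under xor, with
  -- values depending on the edge only, it is the boundary modulo 2. A loop contributes once for
  -- each of its ends.
  endSum : ∀ {n} (G : Graph n) → (End G → Carrier) → Fin n → Carrier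
  endSum G φ v = sum λ e → sum {2} λ i → pick (ends G e i) v (φ (e , i))

  sum-zero : ∀ {n} {f : Fin n → Carrier} → (∀ i → f i ≈ 0#) → sum f ≈ 0#
  sum-zero {n} p = ≈-trans (sum-cong-≋ p) (sum-replicate-zero n)

  sum-single : ∀ {n} {f : Fin n → Carrier} u → (∀ i → i ≢ u → f i ≈ 0#) → sum f ≈ f u
  sum-single {suc n} {f} u p = ≈-trans (sum-remove {i = u} f)
    (≈-trans (∙-congˡ (sum-zero λ i → p (punchIn u i) (punchInᵢ≢i u i))) (identityʳ _))

  sum-double : ∀ {n} {f : Fin n → Carrier} u v → u ≢ v → (∀ i → i ≢ u → i ≢ v → f i ≈ 0#) →
    sum f ≈ f u ∙ f v
  sum-double {suc n} {f} u v u≢v p = ≈-trans (sum-remove {i = u} f) (∙-congˡ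
    (≈-trans (sum-single {f = λ i → f (punchIn u i)} (punchOut u≢v)
               λ i q → p _ (punchInᵢ≢i u i) λ r → q (punchIn-injective u _ _ (trans r (sym (punchIn-punchOut u≢v)))))
             (≈-reflexive (cong f (punchIn-punchOut u≢v)))))

  -- After exchanging the summations, every end is counted at exactly one vertex, because no end
  -- dangles.
  handshake : ∀ {n} (G : Graph n) φ → Closed G →
    sum (endSum G φ) ≈ sum λ e → φ (e , zero) ∙ φ (e , suc zero)
  handshake G φ cl = ≈-trans (∑-comm λ v e → sum {2} λ i → pick (ends G e i) v (φ (e , i)))
    (sum-cong-≋ λ e → ≈-trans (∑-comm λ v i → pick (ends G e i) v (φ (e , i)))
      (∙-cong (side e zero) (≈-trans (identityʳ _) (side e (suc zero)))))
    where
    side : ∀ e i → sum (λ v → pick (ends G e i) v (φ (e , i))) ≈ φ (e , i)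
    side e i with endV G cl e i
    ... | w , q = ≈-trans (sum-single w λ v v≢w → ≈-reflexive
                    (pick-off _ λ r → v≢w (just-injective (trans (sym r) q))))
                    (≈-reflexive (pick-at _ q))

  foldr-tabulate : ∀ {A : Set} n (f : A → Carrier) (g : Fin n → A) →
    foldr _∙_ 0# (map f (tabulate g)) ≡ sum (f ∘ g)
  foldr-tabulate zero    f g = refl
  foldr-tabulate (suc n) f g = cong (f (g zero) ∙_) (foldr-tabulate n f (g ∘ suc))

  private
    lsum : ∀ {A : Set} → (A → Carrier) → List A → Carrier
    lsum φ = foldr (λ h s → φ h ∙ s) 0#

    lsum-++ : ∀ {A : Set} (φ : A → Carrier) xs ys → lsum φ (xs ++ ys) ≈ lsum φ xs ∙ lsum φ ys
    lsum-++ φ []       ys = ≈-sym (identityˡ _)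
    lsum-++ φ (x ∷ xs) ys = ≈-trans (∙-congˡ (lsum-++ φ xs ys)) (≈-sym (assoc _ _ _))

    lsum-concatMap : ∀ {A B : Set} (φ : A → Carrier) (g : B → List A) n (f : Fin n → B) →
      lsum φ (concatMap g (tabulate f)) ≈ sum (λ k → lsum φ (g (f k)))
    lsum-concatMap φ g zero    f = ≈-refl
    lsum-concatMap φ g (suc n) f = ≈-trans (lsum-++ φ (g (f zero)) _)
      (∙-congˡ (lsum-concatMap φ g n (f ∘ suc)))

  -- Links the sum over all edges to the explicit list of ends at `v`; at a cubic vertex the sum
  -- thereby reduces to three terms.
  endSum-list : ∀ {n} (G : Graph n) φ v →
    endSum G φ v ≈ foldr (λ h s → φ h ∙ s) 0# (endsAt G v)
  endSum-list G φ v = ≈-sym (≈-trans (lsum-concatMap φ _ (nE G) id) (sum-cong-≋ λ e →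
    ≈-trans (lsum-concatMap φ (λ i → if ⌊ at? G (e , i) v ⌋ then (e , i) ∷ [] else []) 2 id)
      (sum-cong-≋ (leaf e))))
    where
    leaf : ∀ e i → lsum φ (if ⌊ at? G (e , i) v ⌋ then (e , i) ∷ [] else [])
                 ≈ pick (ends G e i) v (φ (e , i))
    leaf e i with at? G (e , i) v
    ... | yes p = ≈-trans (identityʳ _) (≈-reflexive (sym (pick-at _ p)))
    ... | no p  = ≈-reflexive (sym (pick-off _ p))

module ℕSum = EndSum ℕ.+-0-commutativeMonoid
module 𝔹Sum = EndSum (CommutativeRing.+-commutativeMonoid xor-∧-commutativeRing)

deg-endSum : ∀ {n} (G : Graph n) v → deg G v ≡ ℕSum.endSum G (λ _ → 1) v
deg-endSum G v = trans (ℕSum.foldr-tabulate (nE G) _ id)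
  (ℕSum.sum-cong-≗ λ e → trans (ℕSum.foldr-tabulate 2 (λ i → atN (ends G e i) v) id)
    (ℕSum.sum-cong-≗ {2} λ i → leaf (ends G e i)))
  where
  leaf : ∀ m → atN m v ≡ ℕSum.pick m v 1
  leaf nothing  = refl
  leaf (just w) = refl

deg-length : ∀ {n} (G : Graph n) v → deg G v ≡ length (endsAt G v)
deg-length G v = trans (deg-endSum G v) (trans (ℕSum.endSum-list G (λ _ → 1) v) (count (endsAt G v)))
  where
  count : ∀ {A : Set} (xs : List A) → foldr (λ _ s → 1 ℕ.+ s) 0 xs ≡ length xs
  count []       = refl
  count (x ∷ xs) = cong suc (count xs)

sum-const : ∀ n k → ℕSum.sum {n} (λ _ → k) ≡ n ℕ.* k
sum-const zero    k = refl
sum-const (suc n) k = cong (k ℕ.+_) (sum-const n k)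

degree-sum : ∀ {n} (G : Graph n) → Closed G → ℕSum.sum (deg G) ≡ nE G ℕ.* 2
degree-sum G cl = trans (ℕSum.sum-cong-≗ (deg-endSum G))
  (trans (ℕSum.handshake G (λ _ → 1) cl) (sum-const (nE G) 2))

-- The three edge-ends at a cubic vertex

record Triple {n} (G : Graph n) (v : Fin n) (h₀ h₁ h₂ : End G) : Set where
  field
    at₀ : At G h₀ v
    at₁ : At G h₁ v
    at₂ : At G h₂ v
    d₀₁ : h₀ ≢ h₁
    d₀₂ : h₀ ≢ h₂
    d₁₂ : h₁ ≢ h₂
    exhaust : ∀ h → At G h v → h ≡ h₀ ⊎ h ≡ h₁ ⊎ h ≡ h₂
    total   : ∀ φ → 𝔹Sum.endSum G φ v ≡ φ h₀ xor (φ h₁ xor φ h₂)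

xor-swap : ∀ a b c → a xor (b xor c) ≡ b xor (a xor c)
xor-swap a b c = trans (sym (xor-assoc a b c)) (trans (cong (_xor c) (xor-comm a b)) (xor-assoc b a c))

triple : ∀ {n} (G : Graph n) → (∀ v → deg G v ≡ 3) → ∀ v →
  ∃[ h₀ ] ∃[ h₁ ] ∃[ h₂ ] Triple G v h₀ h₁ h₂
triple G d3 v = go (endsAt G v) refl (trans (sym (deg-length G v)) (d3 v))
  where
  go : ∀ hs → endsAt G v ≡ hs → length hs ≡ 3 → ∃[ h₀ ] ∃[ h₁ ] ∃[ h₂ ] Triple G v h₀ h₁ h₂
  go (h₀ ∷ h₁ ∷ h₂ ∷ []) eq _ with subst Unique eq (endsAt-unique G v)
  ... | (d₀₁ ∷ d₀₂ ∷ []) ∷ (d₁₂ ∷ []) ∷ _ = h₀ , h₁ , h₂ , record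
    { at₀ = ∈-endsAt⁻ G (subst (h₀ ∈ˡ_) (sym eq) (here refl))
    ; at₁ = ∈-endsAt⁻ G (subst (h₁ ∈ˡ_) (sym eq) (there (here refl)))
    ; at₂ = ∈-endsAt⁻ G (subst (h₂ ∈ˡ_) (sym eq) (there (there (here refl))))
    ; d₀₁ = d₀₁ ; d₀₂ = d₀₂ ; d₁₂ = d₁₂
    ; exhaust = λ h p → which (subst (h ∈ˡ_) eq (∈-endsAt⁺ G h p))
    ; total = λ φ → trans (𝔹Sum.endSum-list G φ v)
        (trans (cong (foldr (λ h s → φ h xor s) false) eq)
               (cong (λ s → φ h₀ xor (φ h₁ xor s)) (xor-identityʳ (φ h₂)))) }
    where
    which : ∀ {h} → h ∈ˡ (h₀ ∷ h₁ ∷ h₂ ∷ []) → h ≡ h₀ ⊎ h ≡ h₁ ⊎ h ≡ h₂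
    which (here p)                 = inj₁ p
    which (there (here p))         = inj₂ (inj₁ p)
    which (there (there (here p))) = inj₂ (inj₂ p)

-- The sum in `total` is symmetric, so any of the three ends may be listed first.
tripleAt : ∀ {n} (G : Graph n) → (∀ v → deg G v ≡ 3) → ∀ {v} h → At G h v →
  ∃[ h₁ ] ∃[ h₂ ] Triple G v h h₁ h₂
tripleAt G d3 {v} h p with triple G d3 v
... | h₀ , h₁ , h₂ , t with Triple.exhaust t h p
... | inj₁ refl        = h₁ , h₂ , t
... | inj₂ (inj₁ refl) = h₀ , h₂ , record
  { at₀ = at₁ ; at₁ = at₀ ; at₂ = at₂ ; d₀₁ = d₀₁ ∘ sym ; d₀₂ = d₁₂ ; d₁₂ = d₀₂
  ; exhaust = λ k q → swap (exhaust k q)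
  ; total = λ φ → trans (total φ) (xor-swap (φ h₀) (φ h₁) (φ h₂)) }
  where
  open Triple t
  swap : ∀ {A B C : Set} → A ⊎ B ⊎ C → B ⊎ A ⊎ C
  swap (inj₁ a)        = inj₂ (inj₁ a)
  swap (inj₂ (inj₁ b)) = inj₁ b
  swap (inj₂ (inj₂ c)) = inj₂ (inj₂ c)
... | inj₂ (inj₂ refl) = h₀ , h₁ , record
  { at₀ = at₂ ; at₁ = at₀ ; at₂ = at₁ ; d₀₁ = d₀₂ ∘ sym ; d₀₂ = d₁₂ ∘ sym ; d₁₂ = d₀₁
  ; exhaust = λ k q → rot (exhaust k q)
  ; total = λ φ → trans (total φ) (trans (cong (φ h₀ xor_) (xor-comm (φ h₁) (φ h₂)))
                                         (xor-swap (φ h₀) (φ h₂) (φ h₁))) }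
  where
  open Triple t
  rot : ∀ {A B C : Set} → A ⊎ B ⊎ C → C ⊎ A ⊎ B
  rot (inj₁ a)        = inj₂ (inj₁ a)
  rot (inj₂ (inj₁ b)) = inj₂ (inj₂ b)
  rot (inj₂ (inj₂ c)) = inj₁ c

-- Deleting vertices leaves the edge type unchanged, so G − {u,v} is coloured by a colouring of
-- the edges of G that is only required to be proper away from u and v.
ProperOn : ∀ {n} (G : Graph n) → (Fin n → Set) → (Fin (nE G) → Fin 3) → Set
ProperOn G P c = ∀ h k v → P v → At G h v → At G k v → h ≢ k → c (proj₁ h) ≢ c (proj₁ k)

Off : ∀ {n} → Fin n → Fin n → Fin n → Set
Off u v w = w ≢ u × w ≢ v

proper⇒colourable : ∀ {n} (G : Graph n) {P c} → (∀ v → P v) → ProperOn G P c → Colourable3 G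
proper⇒colourable G all pr = _ , λ e e′ i i′ v → pr (e , i) (e′ , i′) v (all v)

-- Colourings after deletion of two vertices

removeV-just⁺ : ∀ {m} (x : Fin (suc m)) w → removeV x (punchIn x w) ≡ just w
removeV-just⁺ x w with punchIn x w ≟ x
... | yes p = contradiction p (punchInᵢ≢i x w)
... | no p  = cong just (trans (punchOut-cong x refl) (punchOut-punchIn x))

removeV-just⁻ : ∀ {m} (x : Fin (suc m)) {w w′} → removeV x w ≡ just w′ → w ≡ punchIn x w′
removeV-just⁻ x {w} eq with w ≟ x | eq
... | no p | refl = sym (punchIn-punchOut (p ∘ sym))

>>=-just⁻ : ∀ {A B : Set} (m : Maybe A) {f : A → Maybe B} {b} → (m >>= f) ≡ just b →
  ∃[ a ] m ≡ just a × f a ≡ just b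
>>=-just⁻ (just a) eq = a , refl , eq

deleteVertex-at⁺ : ∀ {m} (G : Graph (suc m)) x h {w} → At G h (punchIn x w) → At (deleteVertex G x) h w
deleteVertex-at⁺ G x (e , i) {w} p rewrite p = removeV-just⁺ x w

deleteVertex-at⁻ : ∀ {m} (G : Graph (suc m)) x h {w} → At (deleteVertex G x) h w → At G h (punchIn x w)
deleteVertex-at⁻ G x (e , i) p with >>=-just⁻ (ends G e i) p
... | w , q , r = trans q (cong just (removeV-just⁻ x r))

-- The inclusion of the vertices surviving `deletePair`, which removes `u` and then the position of
-- `v` among the remaining vertices.
skip₂ : ∀ {m} (u v : Fin (suc (suc m))) → u ≢ v → Fin m → Fin (suc (suc m))
skip₂ u v u≢v w = punchIn u (punchIn (punchOut u≢v) w)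

skip₂-off : ∀ {m} (u v : Fin (suc (suc m))) (u≢v : u ≢ v) w → Off u v (skip₂ u v u≢v w)
skip₂-off u v u≢v w = punchInᵢ≢i u _ , λ eq → punchInᵢ≢i (punchOut u≢v) w
  (punchIn-injective u _ _ (trans eq (sym (punchIn-punchOut u≢v))))

skip₂-surj : ∀ {m} (u v : Fin (suc (suc m))) (u≢v : u ≢ v) {w} → Off u v w → ∃[ w′ ] skip₂ u v u≢v w′ ≡ w
skip₂-surj u v u≢v {w} (w≢u , w≢v) = punchOut v′≢w′ ,
  trans (cong (punchIn u) (punchIn-punchOut v′≢w′)) (punchIn-punchOut u≢w)
  where
  u≢w = w≢u ∘ sym
  v′≢w′ : punchOut u≢v ≢ punchOut u≢w
  v′≢w′ eq = w≢v (trans (sym (punchIn-punchOut u≢w)) (trans (cong (punchIn u) (sym eq)) (punchIn-punchOut u≢v)))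

deletePair⁺ : ∀ {n} (G : Graph n) u v u≢v {c} → ProperOn G (Off u v) c → Colourable3 (deletePair G u v u≢v)
deletePair⁺ {suc zero}    G zero zero u≢v pr = contradiction refl u≢v
deletePair⁺ {suc (suc m)} G u v u≢v {c} pr = c , λ e e′ i i′ w p q →
  pr (e , i) (e′ , i′) _ (skip₂-off u v u≢v w) (lift p) (lift q)
  where
  lift : ∀ {h w} → At (deletePair G u v u≢v) h w → At G h (skip₂ u v u≢v w)
  lift {h} p = deleteVertex-at⁻ G u h (deleteVertex-at⁻ (deleteVertex G u) (punchOut u≢v) h p)

deletePair⁻ : ∀ {n} (G : Graph n) u v u≢v → Colourable3 (deletePair G u v u≢v) → ∃[ c ] ProperOn G (Off u v) c
deletePair⁻ {suc zero}    G zero zero u≢v col = contradiction refl u≢v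
deletePair⁻ {suc (suc m)} G u v u≢v (c , pr) = c , λ h k w off p q → body h k w (skip₂-surj u v u≢v off) p q
  where
  body : ∀ h k w → (∃[ w′ ] skip₂ u v u≢v w′ ≡ w) → At G h w → At G k w → h ≢ k → c (proj₁ h) ≢ c (proj₁ k)
  body (e , i) (e′ , i′) w (w′ , refl) p q = pr e e′ i i′ w′ (lower (e , i) p) (lower (e′ , i′) q)
    where
    lower : ∀ h → At G h (skip₂ u v u≢v w′) → At (deletePair G u v u≢v) h w′
    lower h p = deleteVertex-at⁺ (deleteVertex G u) (punchOut u≢v) h (deleteVertex-at⁺ G u h p)

-- Colours as nonzero elements of the Klein four-group

module ℤSum = EndSum ℤ.+-0-commutativeMonoid

lo hi : Fin 3 → Bool
lo zero             = true
lo (suc zero)       = false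
lo (suc (suc zero)) = true
hi zero             = false
hi (suc zero)       = true
hi (suc (suc zero)) = true

klein : Bool → Bool → Fin 3
klein true  false = zero
klein false true  = suc zero
klein true  true  = suc (suc zero)
-- A dummy value: the zero element is no colour, and the hypotheses of `lo-klein` and `hi-klein`
-- exclude it.
klein false false = zero

lo-klein : ∀ p q → p ≡ true ⊎ q ≡ true → lo (klein p q) ≡ p
lo-klein true  false _ = refl
lo-klein false true  _ = refl
lo-klein true  true  _ = refl
lo-klein false false (inj₁ ())
lo-klein false false (inj₂ ())

hi-klein : ∀ p q → p ≡ true ⊎ q ≡ true → hi (klein p q) ≡ q
hi-klein true  false _ = refl
hi-klein false true  _ = refl
hi-klein true  true  _ = refl
hi-klein false false _ = refl

abstract
  -- The sum of two distinct nonzero elements is the third one. The 27 triples are checked by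
  -- evaluation.
  distinct⇒zero-sum : ∀ a b c → a ≢ b → a ≢ c → b ≢ c →
    lo a xor (lo b xor lo c) ≡ false × hi a xor (hi b xor hi c) ≡ false
  distinct⇒zero-sum = toWitness {a? = all? λ a → all? λ b → all? λ c →
    ¬? (a ≟ b) →-dec ¬? (a ≟ c) →-dec ¬? (b ≟ c) →-dec
    ((lo a xor (lo b xor lo c) ≟ᵇ false) ×-dec (hi a xor (hi b xor hi c) ≟ᵇ false))} _

abstract
  -- If two of the elements were equal they would cancel, and the third would be zero.
  zero-sum⇒distinct : ∀ a b c → lo a xor (lo b xor lo c) ≡ false → hi a xor (hi b xor hi c) ≡ false →
    a ≢ b × a ≢ c × b ≢ c
  zero-sum⇒distinct = toWitness {a? = all? λ a → all? λ b → all? λ c →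
    (lo a xor (lo b xor lo c) ≟ᵇ false) →-dec (hi a xor (hi b xor hi c) ≟ᵇ false) →-dec
    (¬? (a ≟ b) ×-dec ¬? (a ≟ c) ×-dec ¬? (b ≟ c))} _

module _ {n} (G : Graph n) (cubic : Cubic G) where

  properOn⇒even : ∀ {P c} → ProperOn G P c → ∀ v → P v →
      𝔹Sum.endSum G (lo ∘ c ∘ proj₁) v ≡ false × 𝔹Sum.endSum G (hi ∘ c ∘ proj₁) v ≡ false
  properOn⇒even {c = c} pr v Pv with triple G (proj₂ cubic) v
  ... | h₀ , h₁ , h₂ , t with distinct⇒zero-sum _ _ _ (pr h₀ h₁ v Pv at₀ at₁ d₀₁)
                                 (pr h₀ h₂ v Pv at₀ at₂ d₀₂) (pr h₁ h₂ v Pv at₁ at₂ d₁₂)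
    where open Triple t
  ... | l , r = trans (Triple.total t (lo ∘ c ∘ proj₁)) l , trans (Triple.total t (hi ∘ c ∘ proj₁)) r

  even⇒properOn : ∀ {P c} →
      (∀ v → P v → 𝔹Sum.endSum G (lo ∘ c ∘ proj₁) v ≡ false × 𝔹Sum.endSum G (hi ∘ c ∘ proj₁) v ≡ false) →
      ProperOn G P c
  even⇒properOn {c = c} ev h k v Pv p q h≢k with tripleAt G (proj₂ cubic) h p | ev v Pv
  ... | h₁ , h₂ , t | l , r with zero-sum⇒distinct (c (proj₁ h)) (c (proj₁ h₁)) (c (proj₁ h₂))
                                   (trans (sym (Triple.total t (lo ∘ c ∘ proj₁))) l)
                                   (trans (sym (Triple.total t (hi ∘ c ∘ proj₁))) r)
                               | Triple.exhaust t k q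
  ... | d₀₁ , d₀₂ , _ | inj₁ k≡h           = contradiction (sym k≡h) h≢k
  ... | d₀₁ , d₀₂ , _ | inj₂ (inj₁ refl) = d₀₁
  ... | d₀₁ , d₀₂ , _ | inj₂ (inj₂ refl) = d₀₂

-- Both ends of an edge carry the same value, and these cancel modulo 2.
even-handshake : ∀ {n} (G : Graph n) → Closed G → (b : Fin (nE G) → Bool) →
  𝔹Sum.sum (𝔹Sum.endSum G (b ∘ proj₁)) ≡ false
even-handshake G cl b = trans (𝔹Sum.handshake G (b ∘ proj₁) cl) (𝔹Sum.sum-zero λ e → xor-same (b e))

-- Eulerian orientations of even multigraphs

δᵇ : ∀ {k} → Fin k → Fin k → Bool
δᵇ w v = ⌊ w ≟ v ⌋

δᶻ : ∀ {k} → Fin k → Fin k → ℤ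
δᶻ w v = atZ (just w) v

δᵇ-refl : ∀ {k} (v : Fin k) → δᵇ v v ≡ true
δᵇ-refl v with v ≟ v
... | yes _ = refl
... | no p  = contradiction refl p

δᵇ-≢ : ∀ {k} {w v : Fin k} → w ≢ v → δᵇ w v ≡ false
δᵇ-≢ {w = w} {v} p with w ≟ v
... | yes q = contradiction q p
... | no _  = refl

IsSign : ℤ → Set
IsSign s = s ≡ 1ℤ ⊎ s ≡ -1ℤ

sum-xor-true : ∀ {m} (f : Fin m → Bool) → 𝔹Sum.sum f ≡ true → ∃[ j ] f j ≡ true
sum-xor-true {suc m} f p with f zero in eq
... | true  = zero , eq
... | false = let j , q = sum-xor-true (f ∘ suc) p in suc j , q

xor-cancel : ∀ a b → a xor b ≡ false → a ≡ b
xor-cancel true  true  _ = refl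
xor-cancel false false _ = refl

_[_↦_] : ∀ {A : Set} {m} → (Fin m → A) → Fin m → A → Fin m → A
(f [ j ↦ a ]) k = if ⌊ k ≟ j ⌋ then a else f k

update-at : ∀ {A : Set} {m} (f : Fin m → A) j a → (f [ j ↦ a ]) j ≡ a
update-at f j a with j ≟ j
... | yes _ = refl
... | no p  = contradiction refl p

update-off : ∀ {A : Set} {m} (f : Fin m → A) {j k} a → k ≢ j → (f [ j ↦ a ]) k ≡ f k
update-off f {j} {k} a p with k ≟ j
... | yes q = contradiction q p
... | no _  = refl

-- Position `j` of `g` absorbs the extra summand `a`, which will be the contribution of an edge
-- merged into edge `j`.
sumᵇ-absorb : ∀ {m} (f g : Fin m → Bool) j a → g j ≡ a xor f j → (∀ k → k ≢ j → g k ≡ f k) →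
  𝔹Sum.sum g ≡ a xor 𝔹Sum.sum f
sumᵇ-absorb {suc m} f g j a p q = trans (𝔹Sum.sum-remove {i = j} g)
  (trans (cong₂ _xor_ p (𝔹Sum.sum-cong-≗ λ k → q _ (punchInᵢ≢i j k)))
  (trans (xor-assoc a (f j) _) (cong (a xor_) (sym (𝔹Sum.sum-remove {i = j} f)))))

sumᶻ-absorb : ∀ {m} (f g : Fin m → ℤ) j a → g j ≡ a ℤ.+ f j → (∀ k → k ≢ j → g k ≡ f k) →
  ℤSum.sum g ≡ a ℤ.+ ℤSum.sum f
sumᶻ-absorb {suc m} f g j a p q = trans (ℤSum.sum-remove {i = j} g)
  (trans (cong₂ ℤ._+_ p (ℤSum.sum-cong-≗ λ k → q _ (punchInᵢ≢i j k)))
  (trans (ℤ.+-assoc a (f j) _) (cong (ℤ._+_ a) (sym (ℤSum.sum-remove {i = j} f)))))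

-- The hypothesis says that the edge from `t` to `h` has exactly one end at `y`. Then `z` is its
-- other end, and `σ` tells whether the reference direction runs from `y` to `z` or back.
eulerian-step : ∀ {k} (t h y : Fin k) → δᵇ t y xor δᵇ h y ≡ true →
  ∃[ z ] ∃[ σ ] IsSign σ × (∀ v → δᵇ t v xor δᵇ h v ≡ δᵇ y v xor δᵇ z v)
                         × (∀ v → (δᶻ h v ℤ.- δᶻ t v) ℤ.* σ ≡ δᶻ z v ℤ.- δᶻ y v)
eulerian-step t h y p with t ≟ y | h ≟ y | p
... | yes refl | no _     | _ = h , 1ℤ , inj₁ refl , (λ v → refl) , λ v → ℤ.*-identityʳ _
... | no _     | yes refl | _ = t , -1ℤ , inj₂ refl , (λ v → xor-comm (δᵇ t v) (δᵇ h v)) , λ v → flip (δᶻ h v) (δᶻ t v)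
  where
  flip : ∀ a b → (a ℤ.- b) ℤ.* -1ℤ ≡ b ℤ.- a
  flip = solve-∀

IsSign-* : ∀ {a b} → IsSign a → IsSign b → IsSign (a ℤ.* b)
IsSign-* (inj₁ refl) (inj₁ refl) = inj₁ refl
IsSign-* (inj₁ refl) (inj₂ refl) = inj₂ refl
IsSign-* (inj₂ refl) (inj₁ refl) = inj₂ refl
IsSign-* (inj₂ refl) (inj₂ refl) = inj₁ refl

Even : ∀ {k m} → (t h : Fin m → Fin k) → Set
Even t h = ∀ v → 𝔹Sum.sum (λ e → δᵇ (t e) v xor δᵇ (h e) v) ≡ false

Balanced : ∀ {k m} → (t h : Fin m → Fin k) → Set
Balanced {m = m} t h = Σ (Fin m → ℤ) λ s → (∀ e → IsSign (s e)) × (∀ v → ℤSum.sum (λ e → (δᶻ (h e) v ℤ.- δᶻ (t e) v) ℤ.* s e) ≡ 0ℤ)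

module _ {k m} (t h : Fin (suc m) → Fin k) where

  even-loop : t zero ≡ h zero → Even t h → Even (t ∘ suc) (h ∘ suc)
  even-loop x≡y even v = trans (cong (_xor 𝔹Sum.sum (λ e → δᵇ (t (suc e)) v xor δᵇ (h (suc e)) v))
    (sym (trans (cong (λ x → δᵇ x v xor δᵇ (h zero) v) x≡y) (xor-same (δᵇ (h zero) v))))) (even v)

  balanced-loop : t zero ≡ h zero → Balanced (t ∘ suc) (h ∘ suc) → Balanced t h
  balanced-loop x≡y (s′ , sgn′ , bal′) = s , sgn , bal
    where
    s : Fin (suc m) → ℤ
    s zero    = 1ℤ
    s (suc e) = s′ e
    sgn : ∀ e → IsSign (s e)
    sgn zero    = inj₁ refl
    sgn (suc e) = sgn′ e
    bal : ∀ v → ℤSum.sum (λ e → (δᶻ (h e) v ℤ.- δᶻ (t e) v) ℤ.* s e) ≡ 0ℤ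
    bal v = cong₂ ℤ._+_ (trans (cong (λ x → (δᶻ (h zero) v ℤ.- δᶻ x v) ℤ.* 1ℤ) x≡y)
                          (cong (ℤ._* 1ℤ) (ℤ.+-inverseʳ (δᶻ (h zero) v))))
                        (bal′ v)

  -- Edge `zero` is no loop and so contributes 1 at its head; by evenness some further edge must
  -- contribute 1 there as well.
  even-next : t zero ≢ h zero → Even t h →
    ∃[ j ] δᵇ (t (suc j)) (h zero) xor δᵇ (h (suc j)) (h zero) ≡ true
  even-next x≢y even = sum-xor-true (λ e → δᵇ (t (suc e)) (h zero) xor δᵇ (h (suc e)) (h zero))
    (sym (xor-cancel true _ (trans
      (cong (_xor 𝔹Sum.sum (λ e → δᵇ (t (suc e)) (h zero) xor δᵇ (h (suc e)) (h zero)))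
            (sym (cong₂ _xor_ (δᵇ-≢ x≢y) (δᵇ-refl (h zero))))) (even (h zero)))))

  module _ (j : Fin m) (z : Fin k) where

    private
      x y : Fin k
      x = t zero
      y = h zero

    spliceᵗ spliceʰ : Fin m → Fin k
    spliceᵗ = (t ∘ suc) [ j ↦ x ]
    spliceʰ = (h ∘ suc) [ j ↦ z ]

    even-splice : (∀ v → δᵇ (t (suc j)) v xor δᵇ (h (suc j)) v ≡ δᵇ y v xor δᵇ z v) →
      Even t h → Even spliceᵗ spliceʰ
    even-splice D-eq even v = trans (sumᵇ-absorb (λ e → δᵇ (t (suc e)) v xor δᵇ (h (suc e)) v) (λ e → δᵇ (spliceᵗ e) v xor δᵇ (spliceʰ e) v)
        j (δᵇ x v xor δᵇ y v)
      (trans (cong₂ (λ a b → δᵇ a v xor δᵇ b v) (update-at (t ∘ suc) j x) (update-at (h ∘ suc) j z))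
        (trans (via (δᵇ x v) (δᵇ y v) (δᵇ z v)) (cong ((δᵇ x v xor δᵇ y v) xor_) (sym (D-eq v)))))
      (λ e e≢j → cong₂ (λ a b → δᵇ a v xor δᵇ b v) (update-off (t ∘ suc) x e≢j) (update-off (h ∘ suc) z e≢j)))
      (even v)
      where
      via : ∀ a b c → a xor c ≡ (a xor b) xor (b xor c)
      via a b c = trans (cong (λ d → a xor (d xor c)) (sym (xor-same b)))
                    (trans (cong (a xor_) (xor-assoc b b c)) (sym (xor-assoc a b (b xor c))))

    -- If the new edge is traversed from x to z, both old edges are traversed along x, y, z. Edge
    -- `zero` has reference direction x to y and inherits the sign unchanged; edge `j` needs the
    -- correction `σ`.
    balanced-splice : ∀ σ → IsSign σ →
      (∀ v → (δᶻ (h (suc j)) v ℤ.- δᶻ (t (suc j)) v) ℤ.* σ ≡ δᶻ z v ℤ.- δᶻ y v) →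
      Balanced spliceᵗ spliceʰ → Balanced t h
    balanced-splice σ σ-sign d-eq (s′ , sgn′ , bal′) = s , sgn , bal
      where
      s : Fin (suc m) → ℤ
      s zero    = s′ j
      s (suc e) = (s′ [ j ↦ σ ℤ.* s′ j ]) e
      sgn : ∀ e → IsSign (s e)
      sgn zero    = sgn′ j
      sgn (suc e) with e ≟ j
      ... | yes _ = IsSign-* σ-sign (sgn′ j)
      ... | no _  = sgn′ e
      via : ∀ a b c d → (c ℤ.- a) ℤ.* d ≡ (b ℤ.- a) ℤ.* d ℤ.+ (c ℤ.- b) ℤ.* d
      via = solve-∀
      bal : ∀ v → ℤSum.sum (λ e → (δᶻ (h e) v ℤ.- δᶻ (t e) v) ℤ.* s e) ≡ 0ℤ
      bal v = trans (sym (sumᶻ-absorb (λ e → (δᶻ (h (suc e)) v ℤ.- δᶻ (t (suc e)) v) ℤ.* s (suc e))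
          (λ e → (δᶻ (spliceʰ e) v ℤ.- δᶻ (spliceᵗ e) v) ℤ.* s′ e) j ((δᶻ y v ℤ.- δᶻ x v) ℤ.* s′ j) at-j off-j)) (bal′ v)
        where
        open ≡-Reasoning
        dⱼ = δᶻ (h (suc j)) v ℤ.- δᶻ (t (suc j)) v
        at-j : (δᶻ (spliceʰ j) v ℤ.- δᶻ (spliceᵗ j) v) ℤ.* s′ j ≡ (δᶻ y v ℤ.- δᶻ x v) ℤ.* s′ j ℤ.+ dⱼ ℤ.* s (suc j)
        at-j = begin
          (δᶻ (spliceʰ j) v ℤ.- δᶻ (spliceᵗ j) v) ℤ.* s′ j
            ≡⟨ cong₂ (λ a b → (δᶻ a v ℤ.- δᶻ b v) ℤ.* s′ j) (update-at (h ∘ suc) j z) (update-at (t ∘ suc) j x) ⟩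
          (δᶻ z v ℤ.- δᶻ x v) ℤ.* s′ j
            ≡⟨ via (δᶻ x v) (δᶻ y v) (δᶻ z v) (s′ j) ⟩
          (δᶻ y v ℤ.- δᶻ x v) ℤ.* s′ j ℤ.+ (δᶻ z v ℤ.- δᶻ y v) ℤ.* s′ j
            ≡⟨ cong (λ d → (δᶻ y v ℤ.- δᶻ x v) ℤ.* s′ j ℤ.+ d ℤ.* s′ j) (d-eq v) ⟨
          (δᶻ y v ℤ.- δᶻ x v) ℤ.* s′ j ℤ.+ (dⱼ ℤ.* σ) ℤ.* s′ j
            ≡⟨ cong (ℤ._+_ ((δᶻ y v ℤ.- δᶻ x v) ℤ.* s′ j)) (ℤ.*-assoc dⱼ σ (s′ j)) ⟩
          (δᶻ y v ℤ.- δᶻ x v) ℤ.* s′ j ℤ.+ dⱼ ℤ.* (σ ℤ.* s′ j)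
            ≡⟨ cong (λ d → (δᶻ y v ℤ.- δᶻ x v) ℤ.* s′ j ℤ.+ dⱼ ℤ.* d) (update-at s′ j (σ ℤ.* s′ j)) ⟨
          (δᶻ y v ℤ.- δᶻ x v) ℤ.* s′ j ℤ.+ dⱼ ℤ.* s (suc j) ∎
        off-j : ∀ e → e ≢ j → (δᶻ (spliceʰ e) v ℤ.- δᶻ (spliceᵗ e) v) ℤ.* s′ e
                            ≡ (δᶻ (h (suc e)) v ℤ.- δᶻ (t (suc e)) v) ℤ.* s (suc e)
        off-j e e≢j = cong₂ ℤ._*_
          (cong₂ (λ a b → δᶻ a v ℤ.- δᶻ b v) (update-off (h ∘ suc) z e≢j) (update-off (t ∘ suc) x e≢j))
          (sym (update-off s′ (σ ℤ.* s′ j) e≢j))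

-- An even multigraph has a balanced orientation: two edges x–y and y–z are replaced by a single
-- edge x–z, and the orientation of the latter is transferred to the path x–y–z.
eulerian-orientation : ∀ {k} m (t h : Fin m → Fin k) → Even t h → Balanced t h
eulerian-orientation zero    t h even = (λ ()) , (λ ()) , λ v → refl
eulerian-orientation (suc m) t h even with t zero ≟ h zero
... | yes x≡y = balanced-loop t h x≡y (eulerian-orientation m (t ∘ suc) (h ∘ suc) (even-loop t h x≡y even))
... | no x≢y with even-next t h x≢y even
...   | j , p with eulerian-step (t (suc j)) (h (suc j)) (h zero) p
...     | z , σ , σ-sign , D-eq , d-eq = balanced-splice t h j z σ σ-sign d-eq
            (eulerian-orientation m (spliceᵗ t h j z) (spliceʰ t h j z) (even-splice t h j z D-eq even))

-- Integer flows and their parities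

netTerm : ∀ {n} (G : Graph n) → (Fin (nE G) → ℤ) → Fin n → Fin (nE G) → ℤ
netTerm G f v e = (atZ (ends G e (suc zero)) v ℤ.- atZ (ends G e zero) v) ℤ.* f e

netFlow-sum : ∀ {n} (G : Graph n) f v → netFlow G f v ≡ ℤSum.sum (netTerm G f v)
netFlow-sum G f v = ℤSum.foldr-tabulate (nE G) (netTerm G f v) id

netFlow-+ : ∀ {n} (G : Graph n) f g v →
  netFlow G (λ e → f e ℤ.+ g e) v ≡ netFlow G f v ℤ.+ netFlow G g v
netFlow-+ G f g v = begin
  netFlow G (λ e → f e ℤ.+ g e) v                               ≡⟨ netFlow-sum G (λ e → f e ℤ.+ g e) v ⟩
  ℤSum.sum (netTerm G (λ e → f e ℤ.+ g e) v)                    ≡⟨ ℤSum.sum-cong-≗ (λ e → ℤ.*-distribˡ-+ (atZ (ends G e (suc zero)) v ℤ.- atZ (ends G e zero) v) (f e) (g e)) ⟩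
  ℤSum.sum (λ e → netTerm G f v e ℤ.+ netTerm G g v e)          ≡⟨ ℤSum.∑-distrib-+ (netTerm G f v) (netTerm G g v) ⟩
  ℤSum.sum (netTerm G f v) ℤ.+ ℤSum.sum (netTerm G g v)         ≡⟨ cong₂ ℤ._+_ (netFlow-sum G f v) (netFlow-sum G g v) ⟨
  netFlow G f v ℤ.+ netFlow G g v                               ∎
  where open ≡-Reasoning

netFlow-cong : ∀ {n} (G : Graph n) {f g} → (∀ e → f e ≡ g e) → ∀ v → netFlow G f v ≡ netFlow G g v
netFlow-cong G {f} {g} eq v = trans (netFlow-sum G f v)
  (trans (ℤSum.sum-cong-≗ λ e → cong (ℤ._*_ (atZ (ends G e (suc zero)) v ℤ.- atZ (ends G e zero) v)) (eq e))
         (sym (netFlow-sum G g v)))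

-- Integer representatives, of absolute value at most 1, of a residue modulo 2.
data Lift : Bool → ℤ → Set where
  off : Lift false 0ℤ
  pos : Lift true 1ℤ
  neg : Lift true -1ℤ

-- The signs of a balanced orientation of the support form a circulation. The loops substituted for
-- the other edges contribute nothing to any balance, so the value there can be reset to 0.
even⇒flow : ∀ {n} (G : Graph n) → Closed G → (b : Fin (nE G) → Bool) →
  (∀ v → 𝔹Sum.endSum G (b ∘ proj₁) v ≡ false) →
  ∃[ f ] (∀ e → Lift (b e) (f e)) × (∀ v → netFlow G f v ≡ 0ℤ)
even⇒flow G cl b even = f , lift , bal
  where
  vert = λ e i → proj₁ (endV G cl e i)
  -- edges outside the support are replaced by loops
  hd tl : Fin (nE G) → Fin _
  hd e = vert e (suc zero)
  tl e = if b e then vert e zero else vert e (suc zero)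
  term : ∀ v e → δᵇ (tl e) v xor δᵇ (hd e) v ≡ 𝔹Sum.sum {2} λ i → 𝔹Sum.pick (ends G e i) v (b e)
  term v e with b e | endV G cl e zero | endV G cl e (suc zero)
  ... | false | x , p | y , q = trans (xor-same (δᵇ y v)) (sym (cong₂ _xor_ (void (ends G e zero)) (cong (_xor false) (void (ends G e (suc zero))))))
    where
    void : ∀ m → 𝔹Sum.pick m v false ≡ false
    void nothing  = refl
    void (just w) with ⌊ w ≟ v ⌋
    ... | true  = refl
    ... | false = refl
  ... | true  | x , p | y , q rewrite p | q =
    cong₂ _xor_ (full x) (trans (full y) (sym (xor-identityʳ _)))
    where
    full : ∀ w → δᵇ w v ≡ 𝔹Sum.pick (just w) v true
    full w with ⌊ w ≟ v ⌋
    ... | true  = refl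
    ... | false = refl
  orient = eulerian-orientation (nE G) tl hd λ v →
    trans (𝔹Sum.sum-cong-≗ (term v)) (even v)
  s = proj₁ orient
  f = λ e → if b e then s e else 0ℤ
  lift : ∀ e → Lift (b e) (f e)
  lift e with b e
  ... | false = off
  ... | true with s e | proj₁ (proj₂ orient) e
  ...   | _ | inj₁ refl = pos
  ...   | _ | inj₂ refl = neg
  bal : ∀ v → netFlow G f v ≡ 0ℤ
  bal v = trans (netFlow-sum G f v) (trans (ℤSum.sum-cong-≗ same) (proj₂ (proj₂ orient) v))
    where
    same : ∀ e → netTerm G f v e ≡ (δᶻ (hd e) v ℤ.- δᶻ (tl e) v) ℤ.* s e
    same e with b e | endV G cl e zero | endV G cl e (suc zero)
    ... | true  | x , p | y , q rewrite p | q = refl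
    ... | false | x , p | y , q = trans (ℤ.*-zeroʳ (atZ (ends G e (suc zero)) v ℤ.- atZ (ends G e zero) v)) (sym (cong (ℤ._* s e) (ℤ.+-inverseʳ (δᶻ y v))))

parityℕ : ℕ → Bool
parityℕ zero    = false
parityℕ (suc n) = not (parityℕ n)

parity : ℤ → Bool
parity i = parityℕ ℤ.∣ i ∣

parityℕ-+ : ∀ m n → parityℕ (m ℕ.+ n) ≡ parityℕ m xor parityℕ n
parityℕ-+ zero    n = refl
parityℕ-+ (suc m) n rewrite parityℕ-+ m n with parityℕ m
... | false = refl
... | true  = not-involutive _

parity-⊖ : ∀ m n → parity (m ℤ.⊖ n) ≡ parityℕ m xor parityℕ n
parity-⊖ zero    zero    = refl
parity-⊖ zero    (suc n) = refl
parity-⊖ (suc m) zero    = sym (xor-identityʳ _)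
parity-⊖ (suc m) (suc n) = trans (cong parity (ℤ.[1+m]⊖[1+n]≡m⊖n m n))
  (trans (parity-⊖ m n) (not-both (parityℕ m) (parityℕ n)))
  where
  not-both : ∀ a b → a xor b ≡ not a xor not b
  not-both false b = sym (not-involutive b)
  not-both true  b = refl

parity-+ : ∀ i j → parity (i ℤ.+ j) ≡ parity i xor parity j
parity-+ (+ m)    (+ n)    = parityℕ-+ m n
parity-+ (+ m)    -[1+ n ] = parity-⊖ m (suc n)
parity-+ -[1+ m ] (+ n)    = trans (parity-⊖ n (suc m)) (xor-comm (parityℕ n) _)
parity-+ -[1+ m ] -[1+ n ] = trans (cong (not ∘ not) (parityℕ-+ m n)) (both (parityℕ m) (parityℕ n))
  where
  both : ∀ a b → not (not (a xor b)) ≡ not a xor not b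
  both false b = refl
  both true  b = not-involutive _

parity-sum : ∀ {m} (f : Fin m → ℤ) → parity (ℤSum.sum f) ≡ 𝔹Sum.sum (parity ∘ f)
parity-sum {zero}  f = refl
parity-sum {suc m} f = trans (parity-+ (f zero) _) (cong (parity (f zero) xor_) (parity-sum (f ∘ suc)))

-- Modulo 2 the opposite signs of head and tail coincide, so inflow minus outflow becomes the sum of
-- the parities over all ends at `v`.
parity-netFlow : ∀ {n} (G : Graph n) f v → netFlow G f v ≡ 0ℤ → 𝔹Sum.endSum G (parity ∘ f ∘ proj₁) v ≡ false
parity-netFlow G f v bal = trans (𝔹Sum.sum-cong-≗ λ e → term (ends G e zero) (ends G e (suc zero)) (f e))
  (trans (sym (parity-sum (netTerm G f v))) (cong parity (trans (sym (netFlow-sum G f v)) bal)))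
  where
  -- One Boolean governs both incidence tests, which leaves only four cases for the two ends of an
  -- edge.
  atN-bool : ∀ m → ∃[ b ] (atN m v ≡ (if b then 1 else 0)) × (∀ a → 𝔹Sum.pick m v a ≡ (if b then a else false))
  atN-bool nothing  = false , refl , λ a → refl
  atN-bool (just w) = ⌊ w ≟ v ⌋ , refl , λ a → refl
  cases : ∀ b b′ i → (if b then parity i else false) xor ((if b′ then parity i else false) xor false)
        ≡ parity ((+ (if b′ then 1 else 0) ℤ.- + (if b then 1 else 0)) ℤ.* i)
  cases false false i = refl
  cases false true  i = trans (xor-identityʳ _) (cong parity (sym (ℤ.*-identityˡ i)))
  cases true  false i = trans (xor-identityʳ _) (sym (trans (cong parity (ℤ.-1*i≡-i i)) (cong parityℕ (ℤ.∣-i∣≡∣i∣ i))))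
  cases true  true  i = trans (cong (parity i xor_) (xor-identityʳ _)) (xor-same (parity i))
  term : ∀ m m′ i → 𝔹Sum.pick m v (parity i) xor (𝔹Sum.pick m′ v (parity i) xor false)
       ≡ parity ((atZ m′ v ℤ.- atZ m v) ℤ.* i)
  term m m′ i with atN-bool m | atN-bool m′
  ... | b , p , q | b′ , p′ , q′ rewrite p | p′ | q (parity i) | q′ (parity i) = cases b b′ i

-- Nowhere-zero 4-flows after identification of two vertices

identify-closed : ∀ {m} (G : Graph (suc m)) u v u≢v → Closed G → Closed (identify G u v u≢v)
identify-closed G u v u≢v cl e i eq with ends G e i in q
... | nothing = cl e i q

mergeV-punchIn : ∀ {m} (u v : Fin (suc m)) u≢v w → mergeV u v u≢v (punchIn u w) ≡ w
mergeV-punchIn u v u≢v w with punchIn u w ≟ u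
... | yes p = contradiction p (punchInᵢ≢i u w)
... | no p  = trans (punchOut-cong u refl) (punchOut-punchIn u)

mergeV-other : ∀ {m} (u v : Fin (suc m)) u≢v {w w′} → mergeV u v u≢v w ≡ w′ → w′ ≢ punchOut u≢v → w ≡ punchIn u w′
mergeV-other u v u≢v {w} refl q with w ≟ u
... | yes p = contradiction refl q
... | no p  = sym (punchIn-punchOut (p ∘ sym))

identify-endSum : ∀ {m} (G : Graph (suc m)) u v u≢v φ w → w ≢ punchOut u≢v →
  𝔹Sum.endSum (identify G u v u≢v) φ w ≡ 𝔹Sum.endSum G φ (punchIn u w)
identify-endSum G u v u≢v φ w w≢ = 𝔹Sum.sum-cong-≗ λ e → 𝔹Sum.sum-cong-≗ {2} λ i →
  𝔹Sum.pick-≗ (φ (e , i)) (back (ends G e i)) (forth (ends G e i))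
  where
  back : ∀ m → (m >>= (just ∘ mergeV u v u≢v)) ≡ just w → m ≡ just (punchIn u w)
  back (just a) eq = cong just (mergeV-other u v u≢v (just-injective eq) w≢)
  forth : ∀ m → m ≡ just (punchIn u w) → (m >>= (just ∘ mergeV u v u≢v)) ≡ just w
  forth _ refl = cong just (mergeV-punchIn u v u≢v w)

properOff⇒flow : ∀ {n} (G : Graph n) → Cubic G → ∀ u v u≢v {c} → ProperOn G (Off u v) c →
  NZ4Flow (identify G u v u≢v)
properOff⇒flow {suc m} G cubic u v u≢v {c} pr =
  -- The flow f₁ + 2f₂; its absolute value is between 1 and 3 because no colour has both coordinates
  -- zero.
  (λ e → proj₁ lowF e ℤ.+ (proj₁ highF e ℤ.+ proj₁ highF e)) ,
  (λ e → nonzero (c e) (proj₁ (proj₂ lowF) e) (proj₁ (proj₂ highF) e)) ,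
  λ w → trans (netFlow-+ G′ (proj₁ lowF) _ w) (cong₂ ℤ._+_ (proj₂ (proj₂ lowF) w)
          (trans (netFlow-+ G′ (proj₁ highF) (proj₁ highF) w)
            (cong₂ ℤ._+_ (proj₂ (proj₂ highF) w) (proj₂ (proj₂ highF) w))))
  where
  G′ = identify G u v u≢v
  cl′ = identify-closed G u v u≢v (proj₁ cubic)
  merged = punchOut u≢v
  shifted : ∀ w → w ≢ merged → Off u v (punchIn u w)
  shifted w w≢ = punchInᵢ≢i u w , λ eq → w≢ (punchIn-injective u _ _ (trans eq (sym (punchIn-punchOut u≢v))))
  even-everywhere : ∀ b → (∀ w → w ≢ merged → 𝔹Sum.endSum G (b ∘ proj₁) (punchIn u w) ≡ false) →
    ∀ w → 𝔹Sum.endSum G′ (b ∘ proj₁) w ≡ false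
  even-everywhere b ev w with w ≟ merged
  ... | no w≢    = trans (identify-endSum G u v u≢v (b ∘ proj₁) w w≢) (ev w w≢)
  -- At the merged vertex evenness comes from the handshake identity, all other boundary terms being
  -- zero.
  ... | yes refl = trans (sym (𝔹Sum.sum-single merged λ w w≢ → trans (identify-endSum G u v u≢v (b ∘ proj₁) w w≢) (ev w w≢)))
                         (even-handshake G′ cl′ b)
  lowF  = even⇒flow G′ cl′ (lo ∘ c) (even-everywhere (lo ∘ c) λ w w≢ → proj₁ (properOn⇒even G cubic pr _ (shifted w w≢)))
  highF = even⇒flow G′ cl′ (hi ∘ c) (even-everywhere (hi ∘ c) λ w w≢ → proj₂ (properOn⇒even G cubic pr _ (shifted w w≢)))
  one≤ : ∀ {k} → 0 ℕ.< suc k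
  one≤ = s≤s z≤n
  nonzero : ∀ a {f g} → Lift (lo a) f → Lift (hi a) g →
    0 ℕ.< ℤ.∣ f ℤ.+ (g ℤ.+ g) ∣ × ℤ.∣ f ℤ.+ (g ℤ.+ g) ∣ ℕ.< 4
  nonzero zero             pos off = one≤ , s≤s one≤
  nonzero zero             neg off = one≤ , s≤s one≤
  nonzero (suc zero)       off pos = one≤ , s≤s (s≤s one≤)
  nonzero (suc zero)       off neg = one≤ , s≤s (s≤s one≤)
  nonzero (suc (suc zero)) pos pos = one≤ , s≤s (s≤s (s≤s one≤))
  nonzero (suc (suc zero)) pos neg = one≤ , s≤s one≤
  nonzero (suc (suc zero)) neg pos = one≤ , s≤s one≤
  nonzero (suc (suc zero)) neg neg = one≤ , s≤s (s≤s (s≤s one≤))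

-- `g` has the parity of `a`, so the sum is even. An even `a` in this range is 2 or -2; then `g` is
-- 0 and the half is odd. Hence the parities of `a` and of the half never vanish together and encode
-- a colour.
halve : ∀ a {g} → 0 ℕ.< ℤ.∣ a ∣ → ℤ.∣ a ∣ ℕ.< 4 → Lift (parity a) g →
  ∃[ h ] a ℤ.+ g ≡ h ℤ.+ h × (parity a ≡ true ⊎ parity h ≡ true)
halve (+ 1) _ _ pos = 1ℤ , refl , inj₁ refl
halve (+ 1) _ _ neg = 0ℤ , refl , inj₁ refl
halve (+ 2) _ _ off = 1ℤ , refl , inj₂ refl
halve (+ 3) _ _ pos = + 2 , refl , inj₁ refl
halve (+ 3) _ _ neg = 1ℤ , refl , inj₁ refl
halve (+ suc (suc (suc (suc n)))) _ (s≤s (s≤s (s≤s (s≤s ())))) _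
halve -[1+ 0 ] _ _ pos = 0ℤ , refl , inj₁ refl
halve -[1+ 0 ] _ _ neg = -1ℤ , refl , inj₁ refl
halve -[1+ 1 ] _ _ off = -1ℤ , refl , inj₂ refl
halve -[1+ 2 ] _ _ pos = -1ℤ , refl , inj₁ refl
halve -[1+ 2 ] _ _ neg = -[1+ 1 ] , refl , inj₁ refl
halve -[1+ suc (suc (suc n)) ] _ (s≤s (s≤s (s≤s (s≤s ())))) _

double≡0 : ∀ i → i ℤ.+ i ≡ 0ℤ → i ≡ 0ℤ
double≡0 (+ zero) _ = refl

flow⇒properOff : ∀ {n} (G : Graph n) → Cubic G → ∀ u v u≢v → NZ4Flow (identify G u v u≢v) →
  ∃[ c ] ProperOn G (Off u v) c
flow⇒properOff {suc m} G cubic u v u≢v (f , nz , bal) = c , even⇒properOn G cubic even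
  where
  G′ = identify G u v u≢v
  odd-part = even⇒flow G′ (identify-closed G u v u≢v (proj₁ cubic)) (parity ∘ f) λ w → parity-netFlow G′ f w (bal w)
  g = proj₁ odd-part
  halves = λ e → halve (f e) (proj₁ (nz e)) (proj₂ (nz e)) (proj₁ (proj₂ odd-part) e)
  h = λ e → proj₁ (halves e)
  h-bal : ∀ w → netFlow G′ h w ≡ 0ℤ
  -- Twice `h` is the circulation `f` + `g`, and doubling is injective on the integers.
  h-bal w = double≡0 _ (begin
    netFlow G′ h w ℤ.+ netFlow G′ h w       ≡⟨ netFlow-+ G′ h h w ⟨
    netFlow G′ (λ e → h e ℤ.+ h e) w        ≡⟨ netFlow-cong G′ (λ e → proj₁ (proj₂ (halves e))) w ⟨
    netFlow G′ (λ e → f e ℤ.+ g e) w        ≡⟨ netFlow-+ G′ f g w ⟩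
    netFlow G′ f w ℤ.+ netFlow G′ g w       ≡⟨ cong₂ ℤ._+_ (bal w) (proj₂ (proj₂ odd-part) w) ⟩
    0ℤ                                      ∎)
    where open ≡-Reasoning
  c = λ e → klein (parity (f e)) (parity (h e))
  descend : ∀ k → (∀ w → netFlow G′ k w ≡ 0ℤ) → ∀ w → Off u v w → 𝔹Sum.endSum G (parity ∘ k ∘ proj₁) w ≡ false
  descend k k-bal w (w≢u , w≢v) = subst (λ x → 𝔹Sum.endSum G (parity ∘ k ∘ proj₁) x ≡ false) (punchIn-punchOut u≢w)
    (trans (sym (identify-endSum G u v u≢v (parity ∘ k ∘ proj₁) (punchOut u≢w) apart)) (parity-netFlow G′ k _ (k-bal _)))
    where
    u≢w = w≢u ∘ sym
    apart : punchOut u≢w ≢ punchOut u≢v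
    apart eq = w≢v (trans (sym (punchIn-punchOut u≢w)) (trans (cong (punchIn u) eq) (punchIn-punchOut u≢v)))
  relabel : ∀ {p q : End G → Bool} → (∀ x → p x ≡ q x) → ∀ w → 𝔹Sum.endSum G p w ≡ 𝔹Sum.endSum G q w
  relabel eq w = 𝔹Sum.sum-cong-≗ λ e → 𝔹Sum.sum-cong-≗ {2} λ i → cong (𝔹Sum.pick (ends G e i) w) (eq (e , i))
  even : ∀ w → Off u v w → 𝔹Sum.endSum G (lo ∘ c ∘ proj₁) w ≡ false × 𝔹Sum.endSum G (hi ∘ c ∘ proj₁) w ≡ false
  even w w∉ =
    trans (relabel (λ (e , i) → lo-klein _ _ (proj₂ (proj₂ (halves e)))) w) (descend f bal w w∉) ,
    trans (relabel (λ (e , i) → hi-klein _ _ (proj₂ (proj₂ (halves e)))) w) (descend h h-bal w w∉)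

-- Edge deletion

-- `punchIn` with source `Fin (pred m)`, as edge deletion produces it; the deleted element itself
-- shows that `m` is a successor.
kept : ∀ {m} → Fin m → Fin (pred m) → Fin m
kept {suc m} = punchIn

kept-≢ : ∀ {m} (e : Fin m) f → kept e f ≢ e
kept-≢ {suc m} = punchInᵢ≢i

kept-surj : ∀ {m} {e f : Fin m} → f ≢ e → ∃[ f′ ] kept e f′ ≡ f
kept-surj {suc m} f≢e = punchOut (f≢e ∘ sym) , punchIn-punchOut (f≢e ∘ sym)

kept-injective : ∀ {m} (e : Fin m) {f g} → kept e f ≡ kept e g → f ≡ g
kept-injective {suc m} e = punchIn-injective e _ _

delEnds-kept : ∀ {n m} (en : Fin m → Fin 2 → Maybe (Fin n)) e f i → delEnds en e f i ≡ en (kept e f) i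
delEnds-kept {m = suc m} en e f i = refl

liftEnd : ∀ {n} (G : Graph n) e → End (deleteEdge G e) → End G
liftEnd G e (f , i) = kept e f , i

liftEnd-injective : ∀ {n} (G : Graph n) e {h k} → liftEnd G e h ≡ liftEnd G e k → h ≡ k
liftEnd-injective G e {h} {k} eq = cong₂ _,_ (kept-injective e (cong proj₁ eq)) (cong proj₂ eq)

deleteEdge-at⁻ : ∀ {n} (G : Graph n) e h {v} → At (deleteEdge G e) h v → At G (liftEnd G e h) v
deleteEdge-at⁻ G e (f , i) p = trans (sym (delEnds-kept (ends G) e f i)) p

deleteEdge-at⁺ : ∀ {n} (G : Graph n) e h {v} → At G (liftEnd G e h) v → At (deleteEdge G e) h v
deleteEdge-at⁺ G e (f , i) p = trans (delEnds-kept (ends G) e f i) p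

endSum-deleteEdge : ∀ {n} (G : Graph n) e v →
  ℕSum.endSum G (λ _ → 1) v ≡
  ℕSum.sum {2} (λ i → ℕSum.pick (ends G e i) v 1) ℕ.+ ℕSum.endSum (deleteEdge G e) (λ _ → 1) v
endSum-deleteEdge record { nE = suc k ; ends = en } e v =
  ℕSum.sum-remove {i = e} (λ f → ℕSum.sum {2} λ i → ℕSum.pick (en f i) v 1)

-- The condition on the opposite end says that `e` is not a loop at `v`, so exactly one end is lost.
deleteEdge-degree : ∀ {n} (G : Graph n) e i {v} → At G (e , i) v → ¬ At G (e , opposite i) v →
  deg G v ≡ suc (deg (deleteEdge G e) v)
deleteEdge-degree G e i {v} p q = trans (deg-endSum G v) (trans (endSum-deleteEdge G e v)
  (cong₂ ℕ._+_ (once i p q) (sym (deg-endSum (deleteEdge G e) v))))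
  where
  once : ∀ i → At G (e , i) v → ¬ At G (e , opposite i) v → ℕSum.sum {2} (λ i → ℕSum.pick (ends G e i) v 1) ≡ 1
  once zero       p q = cong₂ ℕ._+_ (ℕSum.pick-at 1 p) (cong (ℕ._+ 0) (ℕSum.pick-off 1 q))
  once (suc zero) p q = cong₂ ℕ._+_ (ℕSum.pick-off 1 q) (cong (ℕ._+ 0) (ℕSum.pick-at 1 p))

-- Suppression of a vertex of degree two

infix 4 _≟ₑ_
_≟ₑ_ : ∀ {m} (h k : Fin m × Fin 2) → Dec (h ≡ k)
_≟ₑ_ = ≡-dec _≟_ _≟_

-- The two edges e₁ and e₂ at x are fused: q sends edges to their images with section ι, and θ, η
-- are mutually inverse between the ends of the suppressed graph and the ends away from x.
record Suppressed {m} (G : Graph (suc m)) (x : Fin (suc m)) (e₁ e₂ : Fin (nE G)) (G′ : Graph m) : Set where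
  field
    q      : Fin (nE G) → Fin (nE G′)
    ι      : Fin (nE G′) → Fin (nE G)
    ιq     : ∀ e → ι (q e) ≡ e ⊎ (e ≡ e₂ × ι (q e) ≡ e₁)
    θ      : End G′ → End G
    η      : End G → End G′
    θ-edge : ∀ h → q (proj₁ (θ h)) ≡ proj₁ h
    η-edge : ∀ h → proj₁ (η h) ≡ q (proj₁ h)
    θ-at   : ∀ h {w} → At G′ h w → At G (θ h) (punchIn x w)
    η-at   : ∀ h {w} → At G h (punchIn x w) → At G′ (η h) w
    θη     : ∀ h {w} → At G h (punchIn x w) → θ (η h) ≡ h
    ηθ     : ∀ h {w} → At G′ h w → η (θ h) ≡ h

  -- The section may return `e₁` in place of `e₂`, which equal colours on the two fused edges make
  -- invisible.
  colour-ιq : ∀ {A : Set} (c : Fin (nE G) → A) → c e₁ ≡ c e₂ → ∀ e → c (ι (q e)) ≡ c e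
  colour-ιq c eq e with ιq e
  ... | inj₁ p          = cong c p
  ... | inj₂ (refl , p) = trans (cong c p) eq

  colour-θ : ∀ {A : Set} (c : Fin (nE G) → A) → c e₁ ≡ c e₂ → ∀ h → c (ι (proj₁ h)) ≡ c (proj₁ (θ h))
  colour-θ c eq h = trans (cong (c ∘ ι) (sym (θ-edge h))) (colour-ιq c eq (proj₁ (θ h)))

  properOn⁺ : ∀ {P c} → c e₁ ≡ c e₂ → ProperOn G P c → ProperOn G′ (P ∘ punchIn x) (c ∘ ι)
  properOn⁺ {c = c} eq pr h k w Pw p r h≢k cc = pr (θ h) (θ k) _ Pw (θ-at h p) (θ-at k r)
    (λ θθ → h≢k (trans (sym (ηθ h p)) (trans (cong η θθ) (ηθ k r))))
    (trans (sym (colour-θ c eq h)) (trans cc (colour-θ c eq k)))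

  properOn⁻ : ∀ {P c} → ProperOn G′ P c → ProperOn G (λ w → ∃[ w′ ] punchIn x w′ ≡ w × P w′) (c ∘ q)
  properOn⁻ {c = c} pr h k _ (w , refl , Pw) p r h≢k cc = pr (η h) (η k) w Pw (η-at h p) (η-at k r)
    (λ ηη → h≢k (trans (sym (θη h p)) (trans (cong θ ηη) (θη k r))))
    (trans (cong c (η-edge h)) (trans cc (sym (cong c (η-edge k)))))

  -- `θ` and `η` restrict to inverse bijections between the two lists of ends. Thus the second end
  -- of a deleted edge still has degree two after the first has been suppressed.
  degree : ∀ w → length (endsAt G′ w) ≡ length (endsAt G (punchIn x w))
  degree w = ℕ.≤-antisym
    (unique-length-≤ θ (endsAt-unique G′ w) (λ {h} p → ∈-endsAt⁺ G (θ h) (θ-at h (∈-endsAt⁻ G′ p)))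
      λ {h} {k} p r eq → trans (sym (ηθ h (∈-endsAt⁻ G′ p))) (trans (cong η eq) (ηθ k (∈-endsAt⁻ G′ r))))
    (unique-length-≤ η (endsAt-unique G _) (λ {h} p → ∈-endsAt⁺ G′ (η h) (η-at h (∈-endsAt⁻ G p)))
      λ {h} {k} p r eq → trans (sym (θη h (∈-endsAt⁻ G p))) (trans (cong θ eq) (θη k (∈-endsAt⁻ G r))))

-- The intermediate graph in the definition of `suppress`, repeated in the same form so that
-- `suppress-path` holds by computation.
reattach : ∀ {n} (G : Graph n) → Fin (nE G) → Fin 2 → Maybe (Fin n) → Graph n
reattach G e₁ i₁ a = record { nE = nE G ; ends = λ e i → if ⌊ e ≟ e₁ ⌋ ∧ ⌊ i ≟ i₁ ⌋ then a else ends G e i }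

reattach-hit : ∀ {n} (G : Graph n) e₁ i₁ a → ends (reattach G e₁ i₁ a) e₁ i₁ ≡ a
reattach-hit G e₁ i₁ a with e₁ ≟ e₁ | i₁ ≟ i₁
... | yes _ | yes _ = refl
... | yes _ | no q  = contradiction refl q
... | no q  | _     = contradiction refl q

reattach-miss : ∀ {n} (G : Graph n) e₁ i₁ a {e i} → (e , i) ≢ (e₁ , i₁) →
  ends (reattach G e₁ i₁ a) e i ≡ ends G e i
reattach-miss G e₁ i₁ a {e} {i} ne with e ≟ e₁ | i ≟ i₁
... | yes refl | yes refl = contradiction refl ne
... | yes _    | no _     = refl
... | no _     | _        = refl

module _ {m} (G : Graph (suc m)) (x : Fin (suc m)) {e₁ i₁ e₂ i₂} (eq : endsAt G x ≡ (e₁ , i₁) ∷ (e₂ , i₂) ∷ []) where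

  suppress-loop : e₁ ≡ e₂ → suppress G x ≡ deleteVertex G x
  suppress-loop p rewrite eq with e₁ ≟ e₂
  ... | yes _ = refl
  ... | no q  = contradiction p q

  suppress-path : e₁ ≢ e₂ →
    suppress G x ≡ deleteEdge (deleteVertex (reattach G e₁ i₁ (ends G e₂ (opposite i₂))) x) e₂
  suppress-path p rewrite eq with e₁ ≟ e₂
  ... | yes q = contradiction q p
  ... | no _  = refl

  suppressed-loop : Suppressed G x e₁ e₂ (deleteVertex G x)
  suppressed-loop = record
    { q = id ; ι = id ; ιq = λ e → inj₁ refl ; θ = id ; η = id ; θ-edge = λ h → refl ; η-edge = λ h → refl
    ; θ-at = λ h → deleteVertex-at⁻ G x h ; η-at = λ h → deleteVertex-at⁺ G x h
    ; θη = λ h p → refl ; ηθ = λ h p → refl }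

  suppressed-path : e₁ ≢ e₂ →
    Suppressed G x e₁ e₂ (deleteEdge (deleteVertex (reattach G e₁ i₁ (ends G e₂ (opposite i₂))) x) e₂)
  suppressed-path e₁≢e₂ = record
    { q = q ; ι = kept e₂ ; ιq = ιq ; θ = θ ; η = η ; θ-edge = θ-edge ; η-edge = λ h → refl
    ; θ-at = θ-at ; η-at = η-at ; θη = θη ; ηθ = ηθ }
    where
    G₁ = reattach G e₁ i₁ (ends G e₂ (opposite i₂))
    G₂ = deleteVertex G₁ x
    G′ = deleteEdge G₂ e₂
    h₁-at : At G (e₁ , i₁) x
    h₁-at = ∈-endsAt⁻ G (subst ((e₁ , i₁) ∈ˡ_) (sym eq) (here refl))
    h₂-at : At G (e₂ , i₂) x
    h₂-at = ∈-endsAt⁻ G (subst ((e₂ , i₂) ∈ˡ_) (sym eq) (there (here refl)))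

    index : ∀ e → e ≢ e₂ → Fin (nE G′)
    index e p = proj₁ (kept-surj p)
    kept-index : ∀ e p → kept e₂ (index e p) ≡ e
    kept-index e p = proj₂ (kept-surj p)

    qᵈ : ∀ e → Dec (e ≡ e₂) → Fin (nE G′)
    qᵈ e (yes _) = index e₁ e₁≢e₂
    qᵈ e (no p)  = index e p
    q : Fin (nE G) → Fin (nE G′)
    q e = qᵈ e (e ≟ e₂)
    ηᵈ : ∀ e → Fin 2 → Dec (e ≡ e₂) → Fin 2
    -- Both ends of `e₂` are sent to `i₁`; the near one lies at `x`, and only the far one is subject
    -- to the incidence laws.
    ηᵈ e i (yes _) = i₁
    ηᵈ e i (no _)  = i
    η : End G → End G′
    η (e , i) = q e , ηᵈ e i (e ≟ e₂)
    θᵈ : ∀ (h : End G) → Dec (h ≡ (e₁ , i₁)) → End G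
    -- The reattached end of the fused edge stands for the far end of `e₂`.
    θᵈ h (yes _) = e₂ , opposite i₂
    θᵈ h (no _)  = h
    θ : End G′ → End G
    θ (f , i) = θᵈ (kept e₂ f , i) ((kept e₂ f , i) ≟ₑ (e₁ , i₁))

    ιq : ∀ e → kept e₂ (q e) ≡ e ⊎ (e ≡ e₂ × kept e₂ (q e) ≡ e₁)
    ιq e with e ≟ e₂
    ... | yes p = inj₂ (p , kept-index e₁ e₁≢e₂)
    ... | no p  = inj₁ (kept-index e p)

    q-kept : ∀ f {e} → kept e₂ f ≡ e → q e ≡ f
    q-kept f {e} r with e ≟ e₂
    ... | yes refl = contradiction r (kept-≢ e₂ f)
    ... | no p     = kept-injective e₂ (trans (kept-index e p) (sym r))

    q-e₂ : ∀ f → kept e₂ f ≡ e₁ → q e₂ ≡ f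
    q-e₂ f r with e₂ ≟ e₂
    ... | yes _ = kept-injective e₂ (trans (kept-index e₁ e₁≢e₂) (sym r))
    ... | no p  = contradiction refl p

    θ-edge : ∀ h → q (proj₁ (θ h)) ≡ proj₁ h
    θ-edge (f , i) with (kept e₂ f , i) ≟ₑ (e₁ , i₁)
    ... | yes p = q-e₂ f (cong proj₁ p)
    ... | no _  = q-kept f refl

    at₁ : ∀ h {w} → At G′ h w → At G₁ (liftEnd G₂ e₂ h) (punchIn x w)
    at₁ h p = deleteVertex-at⁻ G₁ x (liftEnd G₂ e₂ h) (deleteEdge-at⁻ G₂ e₂ h p)

    θ-at : ∀ h {w} → At G′ h w → At G (θ h) (punchIn x w)
    θ-at (f , i) p with (kept e₂ f , i) ≟ₑ (e₁ , i₁)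
    ... | yes refl = trans (sym (reattach-hit G e₁ i₁ _)) (at₁ (f , i) p)
    ... | no ne    = trans (sym (reattach-miss G e₁ i₁ _ ne)) (at₁ (f , i) p)

    at′ : ∀ f i {w} → At G₁ (kept e₂ f , i) (punchIn x w) → At G′ (f , i) w
    at′ f i p = deleteEdge-at⁺ G₂ e₂ (f , i) (deleteVertex-at⁺ G₁ x (kept e₂ f , i) p)

    not-at-x : ∀ {h k w} → At G h (punchIn x w) → At G k x → h ≢ k
    not-at-x p r refl = punchInᵢ≢i x _ (At-unique G _ p r)

    far-end : ∀ {i w} → At G (e₂ , i) (punchIn x w) → i ≡ opposite i₂
    far-end p = ≢⇒opp {i₂} λ { refl → not-at-x p h₂-at refl }

    η-at : ∀ h {w} → At G h (punchIn x w) → At G′ (η h) w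
    η-at (e , i) p with e ≟ e₂
    ... | yes refl = at′ _ i₁ (trans (cong (λ e → ends G₁ e i₁) (kept-index e₁ e₁≢e₂))
                       (trans (reattach-hit G e₁ i₁ _) (subst (λ j → At G (e₂ , j) _) (far-end p) p)))
    ... | no ne    = at′ _ i (trans (cong (λ e → ends G₁ e i) (kept-index e ne))
                       (trans (reattach-miss G e₁ i₁ _ (not-at-x p h₁-at)) p))

    θη : ∀ h {w} → At G h (punchIn x w) → θ (η h) ≡ h
    θη (e , i) p with e ≟ e₂
    θη (e , i) p | yes refl with (kept e₂ (index e₁ e₁≢e₂) , i₁) ≟ₑ (e₁ , i₁)
    ... | yes _ = cong (e₂ ,_) (sym (far-end p))
    ... | no ne = contradiction (cong (_, i₁) (kept-index e₁ e₁≢e₂)) ne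
    θη (e , i) p | no e≢e₂ with (kept e₂ (index e e≢e₂) , i) ≟ₑ (e₁ , i₁)
    ... | yes r = contradiction (trans (cong (_, i) (sym (kept-index e e≢e₂))) r) (not-at-x p h₁-at)
    ... | no _  = cong (_, i) (kept-index e e≢e₂)

    side-e₂ : ∀ i → ηᵈ e₂ i (e₂ ≟ e₂) ≡ i₁
    side-e₂ i with e₂ ≟ e₂
    ... | yes _ = refl
    ... | no p  = contradiction refl p

    side-kept : ∀ f i → ηᵈ (kept e₂ f) i (kept e₂ f ≟ e₂) ≡ i
    side-kept f i with kept e₂ f ≟ e₂
    ... | yes p = contradiction p (kept-≢ e₂ f)
    ... | no _  = refl

    ηθ : ∀ h {w} → At G′ h w → η (θ h) ≡ h
    ηθ (f , i) p with (kept e₂ f , i) ≟ₑ (e₁ , i₁)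
    ... | yes r = cong₂ _,_ (q-e₂ f (cong proj₁ r)) (trans (side-e₂ _) (sym (cong proj₂ r)))
    ... | no _  = cong₂ _,_ (q-kept f refl) (side-kept f i)

  suppressed : Suppressed G x e₁ e₂ (suppress G x)
  suppressed with e₁ ≟ e₂
  ... | yes p = subst (Suppressed G x e₁ e₂) (sym (suppress-loop p)) suppressed-loop
  ... | no p  = subst (Suppressed G x e₁ e₂) (sym (suppress-path p)) (suppressed-path p)

record Suppression {m} (G : Graph (suc m)) (x : Fin (suc m)) : Set where
  field
    {e₁ e₂} : Fin (nE G)
    {i₁ i₂} : Fin 2
    at₁     : At G (e₁ , i₁) x
    at₂     : At G (e₂ , i₂) x
    spec    : Suppressed G x e₁ e₂ (suppress G x)
  open Suppressed spec public

suppression : ∀ {m} (G : Graph (suc m)) x → length (endsAt G x) ≡ 2 → Suppression G x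
suppression G x = go (endsAt G x) refl
  where
  go : ∀ hs → endsAt G x ≡ hs → length hs ≡ 2 → Suppression G x
  go ((e₁ , i₁) ∷ (e₂ , i₂) ∷ []) eq _ = record
    { at₁ = ∈-endsAt⁻ G (subst ((e₁ , i₁) ∈ˡ_) (sym eq) (here refl))
    ; at₂ = ∈-endsAt⁻ G (subst ((e₂ , i₂) ∈ˡ_) (sym eq) (there (here refl)))
    ; spec = suppressed G x eq }

-- The parity argument

abstract
  -- Each coordinate has total boundary zero by the handshake identity, and every vertex other than
  -- `x` and `y` contributes zero.
  parity-lemma : ∀ {n} (G : Graph n) → Cubic G → ∀ {x y c} → x ≢ y → ProperOn G (Off x y) c →
      𝔹Sum.endSum G (lo ∘ c ∘ proj₁) x ≡ 𝔹Sum.endSum G (lo ∘ c ∘ proj₁) y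
    × 𝔹Sum.endSum G (hi ∘ c ∘ proj₁) x ≡ 𝔹Sum.endSum G (hi ∘ c ∘ proj₁) y
  parity-lemma G cubic {x} {y} {c} x≢y pr =
    balance (lo ∘ c) (λ w w≢x w≢y → proj₁ (properOn⇒even G cubic pr w (w≢x , w≢y))) ,
    balance (hi ∘ c) (λ w w≢x w≢y → proj₂ (properOn⇒even G cubic pr w (w≢x , w≢y)))
    where
    balance : ∀ b → (∀ w → w ≢ x → w ≢ y → 𝔹Sum.endSum G (b ∘ proj₁) w ≡ false) →
      𝔹Sum.endSum G (b ∘ proj₁) x ≡ 𝔹Sum.endSum G (b ∘ proj₁) y
    balance b even = xor-cancel _ _ (trans (sym (𝔹Sum.sum-double {f = 𝔹Sum.endSum G (b ∘ proj₁)} x y x≢y even))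
                                           (even-handshake G (proj₁ cubic) b))

abstract
  -- If the common sum is zero, both pairs are equal. Otherwise it is itself a colour `t`, and a sum
  -- of two nonzero elements differs from both of them.
  four-colours : ∀ a b p q → lo a xor lo b ≡ lo p xor lo q → hi a xor hi b ≡ hi p xor hi q →
    (a ≡ b × p ≡ q) ⊎ (a ≢ b × p ≢ q × ∃[ t ] t ≢ a × t ≢ b × t ≢ p × t ≢ q)
  four-colours = toWitness {a? = all? λ a → all? λ b → all? λ p → all? λ q →
    (lo a xor lo b ≟ᵇ lo p xor lo q) →-dec (hi a xor hi b ≟ᵇ hi p xor hi q) →-dec
    (((a ≟ b) ×-dec (p ≟ q)) ⊎-dec
     (¬? (a ≟ b) ×-dec ¬? (p ≟ q) ×-dec any? λ t → ¬? (t ≟ a) ×-dec ¬? (t ≟ b) ×-dec ¬? (t ≟ p) ×-dec ¬? (t ≟ q)))} _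

xor-cancelˡ : ∀ s a b → s xor a ≡ s xor b → a ≡ b
xor-cancelˡ s a b eq = trans (sym (twice s a)) (trans (cong (s xor_) eq) (twice s b))
  where
  twice : ∀ s a → s xor (s xor a) ≡ a
  twice s a = trans (sym (xor-assoc s s a)) (cong (_xor a) (xor-same s))

triple-proper : ∀ {n} {G : Graph n} {v h₀ h₁ h₂} → Triple G v h₀ h₁ h₂ → (c : Fin (nE G) → Fin 3) →
  c (proj₁ h₀) ≢ c (proj₁ h₁) → c (proj₁ h₀) ≢ c (proj₁ h₂) → c (proj₁ h₁) ≢ c (proj₁ h₂) →
  ∀ h k → At G h v → At G k v → h ≢ k → c (proj₁ h) ≢ c (proj₁ k)
triple-proper t c d₀₁ d₀₂ d₁₂ h k p r h≢k with Triple.exhaust t h p | Triple.exhaust t k r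
... | inj₁ refl        | inj₁ refl        = contradiction refl h≢k
... | inj₁ refl        | inj₂ (inj₁ refl) = d₀₁
... | inj₁ refl        | inj₂ (inj₂ refl) = d₀₂
... | inj₂ (inj₁ refl) | inj₁ refl        = d₀₁ ∘ sym
... | inj₂ (inj₁ refl) | inj₂ (inj₁ refl) = contradiction refl h≢k
... | inj₂ (inj₁ refl) | inj₂ (inj₂ refl) = d₁₂
... | inj₂ (inj₂ refl) | inj₁ refl        = d₀₂ ∘ sym
... | inj₂ (inj₂ refl) | inj₂ (inj₁ refl) = d₁₂ ∘ sym
... | inj₂ (inj₂ refl) | inj₂ (inj₂ refl) = contradiction refl h≢k

OneColour : ∀ {n} (G : Graph n) → (Fin (nE G) → Fin 3) → Fin n → Set
OneColour G c v = ∀ h k → At G h v → At G k v → c (proj₁ h) ≡ c (proj₁ k)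

module _ {n} (G : Graph n) (cubic : Cubic G) (uncol : ¬ Colourable3 G)
         {e x y} (ex : At G (e , zero) x) (ey : At G (e , suc zero) y) (x≢y : x ≢ y)
         {c} (pr : ProperOn G (Off x y) c) where

  private
    -- Only one end of `e` is at `v`, so every other end at `v` belongs to another edge.
    not-e : ∀ {i v h} → At G (e , i) v → ¬ At G (e , opposite i) v → At G h v → h ≢ (e , i) → proj₁ h ≢ e
    not-e {i} {h = _ , j} p r s ne refl with j ≟ i
    ... | yes refl = ne refl
    ... | no j≢i   = r (subst (λ j → At G (e , j) _) (≢⇒opp (j≢i ∘ sym)) s)

    y-off : ¬ At G (e , suc zero) x
    y-off p = x≢y (At-unique G (e , suc zero) p ey)
    x-off : ¬ At G (e , zero) y
    x-off p = x≢y (At-unique G (e , zero) ex p)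

    other-ends : ∀ {h₁ h₂ k₁ k₂} → Triple G x (e , zero) h₁ h₂ → Triple G y (e , suc zero) k₁ k₂ →
      c (proj₁ h₁) ≡ c (proj₁ h₂) × c (proj₁ k₁) ≡ c (proj₁ k₂)
    other-ends {h₁} {h₂} {k₁} {k₂} tx ty = decide
      (four-colours (c (proj₁ h₁)) (c (proj₁ h₂)) (c (proj₁ k₁)) (c (proj₁ k₂))
        (reduce (lo ∘ c) (proj₁ (parity-lemma G cubic x≢y pr)))
        (reduce (hi ∘ c) (proj₂ (parity-lemma G cubic x≢y pr))))
      where
      reduce : ∀ b → 𝔹Sum.endSum G (b ∘ proj₁) x ≡ 𝔹Sum.endSum G (b ∘ proj₁) y →
        b (proj₁ h₁) xor b (proj₁ h₂) ≡ b (proj₁ k₁) xor b (proj₁ k₂)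
      reduce b eq = xor-cancelˡ (b e) _ _
        (trans (sym (Triple.total tx (b ∘ proj₁))) (trans eq (Triple.total ty (b ∘ proj₁))))
      decide : (c (proj₁ h₁) ≡ c (proj₁ h₂) × c (proj₁ k₁) ≡ c (proj₁ k₂))
             ⊎ (c (proj₁ h₁) ≢ c (proj₁ h₂) × c (proj₁ k₁) ≢ c (proj₁ k₂) × ∃[ t ]
                t ≢ c (proj₁ h₁) × t ≢ c (proj₁ h₂) × t ≢ c (proj₁ k₁) × t ≢ c (proj₁ k₂)) →
        c (proj₁ h₁) ≡ c (proj₁ h₂) × c (proj₁ k₁) ≡ c (proj₁ k₂)
      decide (inj₁ same) = same
      -- `t` avoids the colours of all four further ends, so giving it to `e` makes the colouring
      -- proper at `x` and `y` too.
      decide (inj₂ (h≢ , k≢ , t , t≢h₁ , t≢h₂ , t≢k₁ , t≢k₂)) =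
        contradiction (proper⇒colourable G {P = λ _ → ⊤} (λ _ → tt) proper) uncol
        where
        c′ = c [ e ↦ t ]
        old : ∀ {f} → f ≢ e → c′ f ≡ c f
        old = update-off c t
        new : c′ e ≡ t
        new = update-at c e t
        h₁-old = old (not-e ex y-off (Triple.at₁ tx) (Triple.d₀₁ tx ∘ sym))
        h₂-old = old (not-e ex y-off (Triple.at₂ tx) (Triple.d₀₂ tx ∘ sym))
        k₁-old = old (not-e ey x-off (Triple.at₁ ty) (Triple.d₀₁ ty ∘ sym))
        k₂-old = old (not-e ey x-off (Triple.at₂ ty) (Triple.d₀₂ ty ∘ sym))
        via : ∀ {a b a′ b′ : Fin 3} → a ≡ a′ → b ≡ b′ → a′ ≢ b′ → a ≢ b
        via refl refl ne = ne
        away : ∀ {h w} → Off x y w → At G h w → proj₁ h ≢ e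
        away {_ , zero}     (w≢x , _) p refl = w≢x (At-unique G (e , zero) p ex)
        away {_ , suc zero} (_ , w≢y) p refl = w≢y (At-unique G (e , suc zero) p ey)
        proper : ProperOn G (λ _ → ⊤) c′
        proper h k w _ p r h≢k with w ≟ x | w ≟ y
        ... | yes refl | _ = triple-proper tx c′ (via new h₁-old t≢h₁) (via new h₂-old t≢h₂) (via h₁-old h₂-old h≢) h k p r h≢k
        ... | no _ | yes refl = triple-proper ty c′ (via new k₁-old t≢k₁) (via new k₂-old t≢k₂) (via k₁-old k₂-old k≢) h k p r h≢k
        ... | no w≢x | no w≢y = via (old (away {h} (w≢x , w≢y) p)) (old (away {k} (w≢x , w≢y) r)) (pr h k w (w≢x , w≢y) p r h≢k)

    pair-oneColour : ∀ {i v h₁ h₂} → Triple G v (e , i) h₁ h₂ → c (proj₁ h₁) ≡ c (proj₁ h₂) →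
      OneColour (deleteEdge G e) (c ∘ kept e) v
    pair-oneColour {i} {v} {h₁} {h₂} t eq h k p r = trans (to-h₁ h p) (sym (to-h₁ k r))
      where
      to-h₁ : ∀ h → At (deleteEdge G e) h v → c (kept e (proj₁ h)) ≡ c (proj₁ h₁)
      to-h₁ h p with Triple.exhaust t (liftEnd G e h) (deleteEdge-at⁻ G e h p)
      ... | inj₁ q        = contradiction (cong proj₁ q) (kept-≢ e (proj₁ h))
      ... | inj₂ (inj₁ q) = cong (c ∘ proj₁) q
      ... | inj₂ (inj₂ q) = trans (cong (c ∘ proj₁) q) (sym eq)

  dangling-oneColour : OneColour (deleteEdge G e) (c ∘ kept e) x × OneColour (deleteEdge G e) (c ∘ kept e) y
  dangling-oneColour with tripleAt G (proj₂ cubic) (e , zero) ex | tripleAt G (proj₂ cubic) (e , suc zero) ey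
  ... | h₁ , h₂ , tx | k₁ , k₂ , ty =
    pair-oneColour tx (proj₁ (other-ends tx ty)) , pair-oneColour ty (proj₂ (other-ends tx ty))

-- Suppressing both ends of a deleted edge

module Smoothing {m} (G : Graph (suc (suc m))) (cubic : Cubic G) {e x y}
                 (ex : At G (e , zero) x) (ey : At G (e , suc zero) y) (x≢y : x ≢ y) where

  G⁻ : Graph (suc (suc m))
  G⁻ = deleteEdge G e

  y′ : Fin (suc m)
  y′ = punchOut x≢y

  y′-lift : punchIn x y′ ≡ y
  y′-lift = punchIn-punchOut x≢y

  private
    degree-two : ∀ i {v} → At G (e , i) v → ¬ At G (e , opposite i) v → length (endsAt G⁻ v) ≡ 2
    degree-two i {v} p q = trans (sym (deg-length G⁻ v))
      (ℕ.suc-injective (trans (sym (deleteEdge-degree G e i p q)) (proj₂ cubic v)))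

  abstract
    S₁ : Suppression G⁻ x
    S₁ = suppression G⁻ x (degree-two zero ex λ p → x≢y (At-unique G (e , suc zero) p ey))

  module S₁ = Suppression S₁

  abstract
    S₂ : Suppression (suppress G⁻ x) y′
    S₂ = suppression (suppress G⁻ x) y′ (trans (S₁.degree y′) (trans (cong (length ∘ endsAt G⁻) y′-lift)
      (degree-two (suc zero) ey λ p → x≢y (At-unique G (e , zero) ex p))))

  module S₂ = Suppression S₂

  smooth⁺ : ¬ Colourable3 G → ∀ {c} → ProperOn G (Off x y) c → Colourable3 (smooth G e x y x≢y)
  smooth⁺ uncol {c} pr = proper⇒colourable (smooth G e x y x≢y) (skip₂-off x y x≢y)
      (S₂.properOn⁺ {P = Off x y ∘ punchIn x} {c = c₁} eq₂ (S₁.properOn⁺ {P = Off x y} {c = c₀} eq₁ pr₀))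
    where
    c₀ = c ∘ kept e
    c₁ = c₀ ∘ S₁.ι
    pr₀ : ProperOn G⁻ (Off x y) c₀
    pr₀ h k w w∉ p r h≢k = pr (liftEnd G e h) (liftEnd G e k) w w∉ (deleteEdge-at⁻ G e h p) (deleteEdge-at⁻ G e k r)
      (h≢k ∘ liftEnd-injective G e)
    one = dangling-oneColour G cubic uncol ex ey x≢y pr
    eq₁ : c₀ S₁.e₁ ≡ c₀ S₁.e₂
    eq₁ = proj₁ one _ _ S₁.at₁ S₁.at₂
    eq₂ : c₁ S₂.e₁ ≡ c₁ S₂.e₂
    -- The second suppression takes place in the already suppressed graph; `S₁.θ` carries its two
    -- ends back to ends at `y` in `G⁻`, whose colours agree.
    eq₂ = trans (S₁.colour-θ c₀ eq₁ (S₂.e₁ , S₂.i₁))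
      (trans (proj₂ one (S₁.θ (S₂.e₁ , S₂.i₁)) (S₁.θ (S₂.e₂ , S₂.i₂)) (onto S₂.at₁) (onto S₂.at₂))
             (sym (S₁.colour-θ c₀ eq₁ (S₂.e₂ , S₂.i₂))))
      where
      onto : ∀ {h} → At (suppress G⁻ x) h y′ → At G⁻ (S₁.θ h) y
      onto {h} p = trans (S₁.θ-at h p) (cong just y′-lift)

  smooth⁻ : Colourable3 (smooth G e x y x≢y) → ∃[ c ] ProperOn G (Off x y) c
  smooth⁻ (c₂ , pr₂) = c , proper
    where
    c₀ = c₂ ∘ S₂.q ∘ S₁.q
    P₁ = λ w → ∃[ w′ ] punchIn y′ w′ ≡ w × ⊤
    P₀ = λ w → ∃[ w′ ] punchIn x w′ ≡ w × P₁ w′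
    pr₀ : ProperOn G⁻ P₀ c₀
    pr₀ = S₁.properOn⁻ {P = P₁} {c = c₂ ∘ S₂.q} (S₂.properOn⁻ {P = λ _ → ⊤} {c = c₂}
      λ h k w _ p r → pr₂ (proj₁ h) (proj₁ k) (proj₂ h) (proj₂ k) w p r)
    cᵈ : ∀ f → Dec (f ≡ e) → Fin 3
    -- The colour of `e` is arbitrary, since its ends are `x` and `y`, where nothing is required.
    cᵈ f (yes _) = zero
    cᵈ f (no p)  = c₀ (proj₁ (kept-surj p))
    c : Fin (nE G) → Fin 3
    c f = cᵈ f (f ≟ e)
    restrict : ∀ h {w} → At G h w → Off x y w →
      ∃[ h′ ] liftEnd G e h′ ≡ h × At G⁻ h′ w × c (proj₁ h) ≡ c₀ (proj₁ h′)
    restrict (f , i) p (w≢x , w≢y) with f ≟ e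
    restrict (f , zero)     p (w≢x , w≢y) | yes refl = contradiction (At-unique G (f , zero) p ex) w≢x
    restrict (f , suc zero) p (w≢x , w≢y) | yes refl = contradiction (At-unique G (f , suc zero) p ey) w≢y
    restrict (f , i)        p (w≢x , w≢y) | no f≢e with kept-surj f≢e
    ... | f′ , refl = (f′ , i) , refl , deleteEdge-at⁺ G e (f′ , i) p , refl
    proper : ProperOn G (Off x y) c
    proper h k w w∉ p r h≢k cc with restrict h p w∉ | restrict k r w∉ | skip₂-surj x y x≢y w∉
    ... | h′ , refl , p′ , ch | k′ , refl , r′ , ck | w′ , refl =
      pr₀ h′ k′ w (_ , refl , w′ , refl , tt) p′ r′ (h≢k ∘ cong (liftEnd G e)) (trans (sym ch) (trans cc ck))

critical⇒smooth : ∀ {n} (G : Graph n) → Cubic G → ¬ Colourable3 G → Critical G → SmoothColourable G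
critical⇒smooth {suc zero}    G cubic uncol crit e zero zero ex ey x≢y = contradiction refl x≢y
critical⇒smooth {suc (suc m)} G cubic uncol crit e x y ex ey x≢y =
  Smoothing.smooth⁺ G cubic ex ey x≢y uncol (proj₂ (deletePair⁻ G x y x≢y (crit x y x≢y (e , inj₁ (ex , ey)))))

smooth⇒critical : ∀ {n} (G : Graph n) → Cubic G → SmoothColourable G → Critical G
smooth⇒critical {suc zero}    G cubic sm zero zero u≢v adj = contradiction refl u≢v
smooth⇒critical {suc (suc m)} G cubic sm u v u≢v (e , inj₁ (eu , ev)) =
  deletePair⁺ G u v u≢v (proj₂ (Smoothing.smooth⁻ G cubic eu ev u≢v (sm e u v eu ev u≢v)))
smooth⇒critical {suc (suc m)} G cubic sm u v u≢v (e , inj₂ (ev , eu)) =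
  deletePair⁺ G u v u≢v λ h k w (w≢u , w≢v) → pr h k w (w≢v , w≢u)
  where
  pr = proj₂ (Smoothing.smooth⁻ G cubic ev eu (u≢v ∘ sym) (sm e v u ev eu (u≢v ∘ sym)))

critical⇒flow : ∀ {n} (G : Graph n) → Cubic G → Critical G → FourEdgeCritical G
critical⇒flow G cubic crit u v u≢v adj = properOff⇒flow G cubic u v u≢v (proj₂ (deletePair⁻ G u v u≢v (crit u v u≢v adj)))

flow⇒critical : ∀ {n} (G : Graph n) → Cubic G → FourEdgeCritical G → Critical G
flow⇒critical G cubic fl u v u≢v adj = deletePair⁺ G u v u≢v (proj₂ (flow⇒properOff G cubic u v u≢v (fl u v u≢v adj)))

-- Opposite ends and embeddings

flip : ∀ {n} {G : Graph n} → End G → End G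
flip (e , i) = e , opposite i

flip-flip : ∀ {n} {G : Graph n} (h : End G) → flip {G = G} (flip {G = G} h) ≡ h
flip-flip (e , i) = cong (e ,_) (opposite-involutive i)

flip-≢ : ∀ {n} {G : Graph n} (h : End G) → flip {G = G} h ≢ h
flip-≢ (e , i) eq = opp≢ i (cong proj₂ eq)

same-edge : ∀ {n} {G : Graph n} {h k : End G} → proj₁ h ≡ proj₁ k → h ≢ k → k ≡ flip {G = G} h
same-edge {h = e , i} {.e , j} refl h≢k = cong (e ,_) (≢⇒opp (h≢k ∘ cong (e ,_)))

adj : ∀ {n} (G : Graph n) h {x y} → At G h x → At G (flip {G = G} h) y → Adj G x y
adj G (e , zero)     p q = e , inj₁ (p , q)
adj G (e , suc zero) p q = e , inj₂ (q , p)

adj⁻ : ∀ {n} (G : Graph n) {x y} → Adj G x y → ∃[ h ] At G h x × At G (flip {G = G} h) y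
adj⁻ G (e , inj₁ (p , q)) = (e , zero) , p , q
adj⁻ G (e , inj₂ (p , q)) = (e , suc zero) , q , p

module Embedded {k n} {K : Graph k} {G : Graph n} (φ : Embedding K G) where

  private
    -- An embedding may reverse the reference orientation of an edge, so its action on ends follows
    -- the alternative chosen by `pres`.
    side : (e : Fin (nE K)) → (∀ i → ends G (φE φ e) i ≡ Maybe.map (φV φ) (ends K e i))
                            ⊎ (∀ i → ends G (φE φ e) i ≡ Maybe.map (φV φ) (ends K e (opposite i))) →
      Fin 2 → Fin 2
    side e (inj₁ _) i = i
    side e (inj₂ _) i = opposite i

    side-injective : ∀ e p {i j} → side e p i ≡ side e p j → i ≡ j
    side-injective e (inj₁ _) eq = eq
    side-injective e (inj₂ _) {i} {j} eq =
      trans (sym (opposite-involutive i)) (trans (cong opposite eq) (opposite-involutive j))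

  embedEnd : End K → End G
  embedEnd (e , i) = φE φ e , side e (pres φ e) i

  embedEnd-injective : ∀ {h k} → embedEnd h ≡ embedEnd k → h ≡ k
  embedEnd-injective {e , i} {f , j} eq with injE φ (cong proj₁ eq)
  ... | refl = cong (e ,_) (side-injective e (pres φ e) (cong proj₂ eq))

  embedEnd-at : ∀ h {v} → At K h v → At G (embedEnd h) (φV φ v)
  embedEnd-at (e , i) p with pres φ e
  ... | inj₁ eq = trans (eq i) (cong (Maybe.map (φV φ)) p)
  ... | inj₂ eq = trans (eq (opposite i)) (cong (Maybe.map (φV φ))
                    (trans (cong (ends K e) (opposite-involutive i)) p))

  image-vertex : ∀ e i {v} → At G (φE φ e , i) v → ∃[ w ] φV φ w ≡ v
  image-vertex e i p with pres φ e
  ... | inj₁ eq = preimage (ends K e i) (trans (sym (eq i)) p)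
    where
    preimage : ∀ m {v} → Maybe.map (φV φ) m ≡ just v → ∃[ w ] φV φ w ≡ v
    preimage (just w) r = w , just-injective r
  ... | inj₂ eq = preimage (ends K e (opposite i)) (trans (sym (eq i)) p)
    where
    preimage : ∀ m {v} → Maybe.map (φV φ) m ≡ just v → ∃[ w ] φV φ w ≡ v
    preimage (just w) r = w , just-injective r

  restrict-colouring : ∀ {P c} → ProperOn G P c → (∀ v → P (φV φ v)) → Colourable3 K
  restrict-colouring {c = c} pr all = c ∘ φE φ , λ e e′ i i′ v p q ne →
    pr (embedEnd (e , i)) (embedEnd (e′ , i′)) (φV φ v) (all v) (embedEnd-at (e , i) p) (embedEnd-at (e′ , i′) q)
      (ne ∘ embedEnd-injective)

  degree-≤ : ∀ v → deg K v ≤ deg G (φV φ v)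
  degree-≤ v = subst₂ _≤_ (sym (deg-length K v)) (sym (deg-length G (φV φ v)))
    (unique-length-≤ embedEnd (endsAt-unique K v) (λ {h} p → ∈-endsAt⁺ G (embedEnd h) (embedEnd-at h (∈-endsAt⁻ K p)))
      λ _ _ → embedEnd-injective)

-- From criticality to 6-irreducibility

cubic-size : ∀ {n} (G : Graph n) → Cubic G → n ℕ.* 3 ≡ nE G ℕ.* 2
cubic-size {n} G (cl , d3) = trans (sym (sum-const n 3)) (trans (sym (ℕSum.sum-cong-≗ d3)) (degree-sum G cl))

parityℕ-double : ∀ n → parityℕ (n ℕ.* 2) ≡ false
parityℕ-double zero    = refl
parityℕ-double (suc n) = trans (not-involutive _) (parityℕ-double n)

-- Three times the order is twice the number of edges, so cubic graphs have even order.
cubic-not-consecutive : ∀ {m} (G : Graph (suc m)) (H : Graph m) → Cubic G → Cubic H → ⊥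
cubic-not-consecutive G H cG cH = contradiction
  (trans (sym (trans (cong (not ∘ not ∘ not ∘ parityℕ) (cubic-size H cH)) (cong (not ∘ not ∘ not) (parityℕ-double (nE H)))))
         (trans (cong parityℕ (cubic-size G cG)) (parityℕ-double (nE G)))) λ ()

unique⇒length≤∣∣ : ∀ {m} {S : Subset m} {xs} → Unique xs → All (_∈ S) xs → length xs ≤ ∣ S ∣
unique⇒length≤∣∣ [] [] = z≤n
unique⇒length≤∣∣ {S = S} (x∉ ∷ u) (x∈ ∷ xs∈) = ℕ.≤-trans
  (s≤s (unique⇒length≤∣∣ u (All.map (λ (y∈ , x≢y) → x∈p∧x≢y⇒x∈p-y y∈ (x≢y ∘ sym)) (All.zip (xs∈ , x∉)))))
  (x∈p⇒∣p-x∣<∣p∣ x∈)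

module Reduction {n} (G : Graph n) (conn : Connected G) (cubic : Cubic G) (crit : Critical G)
                 (S : Subset (nE G)) (∣S∣<6 : ∣ S ∣ < 6)
                 {j} (K : Graph j) (comp : IsComponentMinus G S K) (uncol : ¬ Colourable3 K)
                 {h} (H : Graph h) (cubicH : Cubic H) (h<n : h < n) (ψ : Embedding K H) where

  private
    φ = proj₁ comp
    saturated = proj₂ (proj₂ (proj₂ comp))
    open Embedded φ

    _ᶠ : End G → End G
    _ᶠ = flip {G = G}

    Inside : Fin n → Set
    Inside w = ∃[ v ] φV φ v ≡ w

    inside? : ∀ w → Dec (Inside w)
    inside? w = any? λ v → φV φ v ≟ w

    far : ∀ (k : End G) → ∃[ w ] At G (k ᶠ) w
    far (e , i) = endV G (proj₁ cubic) e (opposite i)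

    -- Otherwise the colouring of G - {x,y} given by criticality would restrict to `K`.
    no-adjacent-pair : ∀ {x y} → x ≢ y → Adj G x y → ¬ Inside x → ¬ Inside y → ⊥
    no-adjacent-pair {x} {y} x≢y a x∉ y∉ = uncol (restrict-colouring (proj₂ (deletePair⁻ G x y x≢y (crit x y x≢y a)))
      λ v → (λ eq → x∉ (v , eq)) , λ eq → y∉ (v , eq))

    neighbour-inside : ∀ {u w} k → ¬ Inside u → At G k u → At G (k ᶠ) w → w ≢ u → Inside w
    neighbour-inside {u} {w} k u∉ p q w≢u = decidable-stable (inside? w) λ w∉ →
      no-adjacent-pair (w≢u ∘ sym) (adj G k p q) u∉ w∉

    -- The far end `w` lies in the component. Were the edge not removed, the component would contain
    -- it, and with it the vertex `u`.
    missing-edge-cut : ∀ {u w} k → ¬ Inside u → At G k u → At G (k ᶠ) w → w ≢ u → proj₁ k ∈ S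
    missing-edge-cut {u} k u∉ p q w≢u = decidable-stable (proj₁ k ∈? S) λ k∉S → u∉ (back k∉S)
      where
      back : proj₁ k ∉ S → Inside u
      back k∉S with neighbour-inside k u∉ p q w≢u
      ... | v , refl with saturated _ _ v k∉S q
      ... | e′ , refl = image-vertex e′ _ p

    j≤h : j ≤ h
    j≤h = injective⇒≤ (injV ψ)

    -- If `u` alone is missing, then n - 1 ≤ j ≤ h ≤ n - 1, so `G` and `H` would be cubic graphs of
    -- consecutive orders.
    not-only-missing : ∀ {u} → ¬ Inside u → ¬ (∀ w → w ≢ u → Inside w)
    not-only-missing {u} u∉ all = go n G cubic (φV φ) u all h<n
      where
      go : ∀ n (G : Graph n) → Cubic G → (f : Fin j → Fin n) (u : Fin n) →
        (∀ w → w ≢ u → ∃[ v ] f v ≡ w) → h < n → ⊥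
      go (suc m) G cG f u all (s≤s h≤m) with ℕ.≤-antisym h≤m (ℕ.≤-trans (injective⇒≤ pre-injective) j≤h)
        where
        pre : Fin m → Fin j
        pre w = proj₁ (all (punchIn u w) (punchInᵢ≢i u w))
        pre-injective : ∀ {w w′} → pre w ≡ pre w′ → w ≡ w′
        pre-injective {w} {w′} eq = punchIn-injective u w w′
          (trans (sym (proj₂ (all (punchIn u w) (punchInᵢ≢i u w))))
            (trans (cong f eq) (proj₂ (all (punchIn u w′) (punchInᵢ≢i u w′)))))
      ... | refl = cubic-not-consecutive G H cG cubicH

    exists-missing : ∃[ u ] ¬ Inside u
    exists-missing = ¬∀⟶∃¬ n Inside inside? λ all → ℕ.<-irrefl refl
      (ℕ.<-≤-trans h<n (ℕ.≤-trans (injective⇒≤ {f = proj₁ ∘ all}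
        λ {x} {y} eq → trans (sym (proj₂ (all x))) (trans (cong (φV φ) eq) (proj₂ (all y)))) j≤h))

    -- A loop at u is joined to the rest of G by an edge uv.  Unless v carries a loop as well, there
    -- is an edge vw with G − {v,w} containing the loop; otherwise u and v are the only vertices.
    module Loop {u} (u∉ : ¬ Inside u) (l k : End G) (lu : At G l u) (lu′ : At G (l ᶠ) u) (ku : At G k u)
                (ends-u : ∀ g → At G g u → g ≡ l ⊎ g ≡ l ᶠ ⊎ g ≡ k) (k≢l : k ≢ l) (k≢l′ : k ≢ l ᶠ) where
      v : Fin n
      v = proj₁ (far k)
      kv : At G (k ᶠ) v
      kv = proj₂ (far k)

      k-edge : proj₁ l ≢ proj₁ k
      k-edge eq = k≢l′ (same-edge {G = G} eq (k≢l ∘ sym))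

      v≢u : v ≢ u
      v≢u v≡u with ends-u (k ᶠ) (subst (At G (k ᶠ)) v≡u kv)
      ... | inj₁ eq        = k-edge (sym (cong proj₁ eq))
      ... | inj₂ (inj₁ eq) = k-edge (sym (cong proj₁ eq))
      ... | inj₂ (inj₂ eq) = flip-≢ {G = G} k eq

      not-to-u : ∀ g → At G g v → g ≢ k ᶠ → ¬ At G (g ᶠ) u
      not-to-u g gv g≢k gu with ends-u (g ᶠ) gu
      ... | inj₁ eq        = v≢u (At-unique G g gv (subst (λ x → At G x u) (trans (cong _ᶠ (sym eq)) (flip-flip {G = G} g)) lu′))
      ... | inj₂ (inj₁ eq) = v≢u (At-unique G g gv
        (subst (λ x → At G x u) (trans (sym (flip-flip {G = G} l)) (trans (cong _ᶠ (sym eq)) (flip-flip {G = G} g))) lu))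
      ... | inj₂ (inj₂ eq) = g≢k (trans (sym (flip-flip {G = G} g)) (cong _ᶠ eq))

      loop-at-v : ∀ g → At G g v → g ≢ k ᶠ → At G (g ᶠ) v
      loop-at-v g gv g≢k with far g
      ... | w , gw with w ≟ v
      ...   | yes refl = gw
      ...   | no w≢v   = ⊥-elim (pr l (l ᶠ) u (v≢u ∘ sym , λ { refl → not-to-u g gv g≢k gw }) lu lu′
                           (flip-≢ {G = G} l ∘ sym) refl)
        where pr = proj₂ (deletePair⁻ G v w (w≢v ∘ sym) (crit v w (w≢v ∘ sym) (adj G g gv gw)))

      Two : Fin n → Set
      Two w = w ≡ u ⊎ w ≡ v

      two-step : ∀ {x y} → Two x → Adj G x y → Two y
      two-step tx a with adj⁻ G a
      two-step (inj₁ refl) a | g , gx , gy with ends-u g gx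
      ... | inj₁ refl        = inj₁ (At-unique G (l ᶠ) gy lu′)
      ... | inj₂ (inj₁ refl) = inj₁ (At-unique G l (subst (λ x → At G x _) (flip-flip {G = G} l) gy) lu)
      ... | inj₂ (inj₂ refl) = inj₂ (At-unique G (k ᶠ) gy kv)
      two-step (inj₂ refl) a | g , gx , gy with g ≟ₑ (k ᶠ)
      ... | yes refl = inj₁ (At-unique G k (subst (λ x → At G x _) (flip-flip {G = G} k) gy) ku)
      ... | no g≢k   = inj₂ (At-unique G (g ᶠ) gy (loop-at-v g gx g≢k))

      two-star : ∀ {x y} → Two x → Star (Adj G) x y → Two y
      two-star tx ε       = tx
      two-star tx (a ◅ s) = two-star (two-step tx a) s

      impossible : ⊥
      impossible = not-only-missing u∉ λ w w≢u → [ (λ w≡u → contradiction w≡u w≢u) ,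
        (λ { refl → neighbour-inside k u∉ ku kv w≢u }) ] (two-star (inj₁ refl) (conn u w))

    no-loop : ∀ {u} → ¬ Inside u → ∀ l → At G l u → ¬ At G (l ᶠ) u
    no-loop {u} u∉ l lu lu′ with tripleAt G (proj₂ cubic) l lu
    ... | h₁ , h₂ , t with Triple.exhaust t (l ᶠ) lu′
    ... | inj₁ eq          = flip-≢ {G = G} l eq
    ... | inj₂ (inj₁ refl) = Loop.impossible u∉ l h₂ lu lu′ at₂ exhaust (d₀₂ ∘ sym) (d₁₂ ∘ sym)
      where open Triple t
    ... | inj₂ (inj₂ refl) = Loop.impossible u∉ l h₁ lu lu′ at₁ (λ g p → [ inj₁ , [ inj₂ ∘ inj₂ , inj₂ ∘ inj₁ ] ] (exhaust g p)) (d₀₁ ∘ sym) d₁₂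
      where open Triple t

    missing-edge : ∀ {u} → ¬ Inside u → ∀ k → At G k u → proj₁ k ∈ S
    missing-edge u∉ k ku = missing-edge-cut k u∉ ku (proj₂ (far k))
      λ { refl → no-loop u∉ k ku (proj₂ (far k)) }

    -- The edges at two missing vertices are six distinct members of S.
    no-two-missing : ∀ {u u′} → u ≢ u′ → ¬ Inside u → ¬ Inside u′ → ⊥
    no-two-missing {u} {u′} u≢u′ u∉ u′∉ with triple G (proj₂ cubic) u | triple G (proj₂ cubic) u′
    ... | h₀ , h₁ , h₂ , t | k₀ , k₁ , k₂ , t′ = ℕ.<⇒≱ ∣S∣<6 (unique⇒length≤∣∣
          ((same u∉ T.at₀ T.at₁ T.d₀₁ ∷ same u∉ T.at₀ T.at₂ T.d₀₂ ∷ cross T.at₀ T′.at₀ ∷ cross T.at₀ T′.at₁ ∷ cross T.at₀ T′.at₂ ∷ [])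
          ∷ (same u∉ T.at₁ T.at₂ T.d₁₂ ∷ cross T.at₁ T′.at₀ ∷ cross T.at₁ T′.at₁ ∷ cross T.at₁ T′.at₂ ∷ [])
          ∷ (cross T.at₂ T′.at₀ ∷ cross T.at₂ T′.at₁ ∷ cross T.at₂ T′.at₂ ∷ [])
          ∷ (same u′∉ T′.at₀ T′.at₁ T′.d₀₁ ∷ same u′∉ T′.at₀ T′.at₂ T′.d₀₂ ∷ [])
          ∷ (same u′∉ T′.at₁ T′.at₂ T′.d₁₂ ∷ []) ∷ [] ∷ [])
          (missing-edge u∉ h₀ T.at₀ ∷ missing-edge u∉ h₁ T.at₁ ∷ missing-edge u∉ h₂ T.at₂
          ∷ missing-edge u′∉ k₀ T′.at₀ ∷ missing-edge u′∉ k₁ T′.at₁ ∷ missing-edge u′∉ k₂ T′.at₂ ∷ []))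
      where
      module T = Triple t
      module T′ = Triple t′
      same : ∀ {w} → ¬ Inside w → ∀ {g g′} → At G g w → At G g′ w → g ≢ g′ → proj₁ g ≢ proj₁ g′
      same w∉ {g} p q g≢g′ eq = no-loop w∉ g p (subst (λ x → At G x _) (same-edge {G = G} eq g≢g′) q)
      cross : ∀ {g g′} → At G g u → At G g′ u′ → proj₁ g ≢ proj₁ g′
      cross {g} p q eq = no-adjacent-pair u≢u′ (adj G g p (subst (λ x → At G x u′)
        (same-edge {G = G} {h = g} eq λ { refl → u≢u′ (At-unique G g p q) }) q)) u∉ u′∉

  irreducible : ⊥
  irreducible with exists-missing
  ... | u , u∉ = not-only-missing u∉ λ w w≢u → decidable-stable (inside? w) λ w∉ → no-two-missing w≢u w∉ u∉

critical⇒irreducible : ∀ {n} (G : Graph n) → Connected G → Cubic G → Critical G → Irreducible 6 G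
critical⇒irreducible G conn cubic crit S ∣S∣<6 K comp uncol (h , H , cubicH , h<n , ψ) =
  Reduction.irreducible G conn cubic crit S ∣S∣<6 K comp uncol H cubicH h<n ψ

irreducible-mono : ∀ {k l n} (G : Graph n) → k ≤ l → Irreducible l G → Irreducible k G
irreducible-mono G k≤l irr S ∣S∣<k = irr S (ℕ.<-≤-trans ∣S∣<k k≤l)

-- Completing a subcubic graph to a cubic one

isolate : ∀ {n} → Graph n → Graph (suc n)
isolate = mapV (just ∘ suc)

just-suc⁻ : ∀ {n} (m : Maybe (Fin n)) {v} → (m >>= (just ∘ suc)) ≡ just (suc v) → m ≡ just v
just-suc⁻ (just w) eq = cong just (suc-injective (just-injective eq))

isolate-deg-zero : ∀ {n} (G : Graph n) → deg (isolate G) zero ≡ 0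
isolate-deg-zero G = trans (deg-endSum (isolate G) zero) (ℕSum.sum-zero λ e → ℕSum.sum-zero {2} λ i →
  ℕSum.pick-off 1 (never (ends G e i)))
  where
  never : ∀ m → (m >>= (just ∘ suc)) ≢ just zero
  never (just w) ()

isolate-deg-suc : ∀ {n} (G : Graph n) v → deg (isolate G) (suc v) ≡ deg G v
isolate-deg-suc G v = trans (deg-endSum (isolate G) (suc v)) (trans
  (ℕSum.sum-cong-≗ λ e → ℕSum.sum-cong-≗ {2} λ i → ℕSum.pick-≗ {v′ = v} 1 (just-suc⁻ (ends G e i)) (λ eq → cong (_>>= (just ∘ suc)) eq))
  (sym (deg-endSum G v)))

addEdge : ∀ {n} → Graph n → Fin n → Fin n → Graph n
addEdge G a b = record { nE = suc (nE G) ; ends = λ { zero zero → just a ; zero (suc zero) → just b ; (suc e) i → ends G e i } }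

addEdge-deg : ∀ {n} (G : Graph n) a b v → deg (addEdge G a b) v ≡ atN (just a) v ℕ.+ (atN (just b) v ℕ.+ 0) ℕ.+ deg G v
addEdge-deg G a b v = trans (deg-endSum (addEdge G a b) v)
  (cong (atN (just a) v ℕ.+ (atN (just b) v ℕ.+ 0) ℕ.+_) (sym (deg-endSum G v)))

atN-suc : ∀ {n} (a v : Fin n) → atN (just (suc a)) (suc v) ≡ atN (just a) v
atN-suc a v with a ≟ v
... | yes _ = refl
... | no _  = refl

-- A positive total provides a vertex where one missing edge-end can be supplied.
take-unit : ∀ {n} (g : Fin n → ℕ) {s} → ℕSum.sum g ≡ suc s →
  ∃[ a ] Σ (Fin n → ℕ) λ g′ → (∀ v → g v ≡ atN (just a) v ℕ.+ g′ v) × ℕSum.sum g′ ≡ s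
take-unit {suc n} g {s} eq with g zero in g₀
... | suc k = zero , g′ , split , ℕ.suc-injective eq
  where
  g′ : Fin (suc n) → ℕ
  g′ zero    = k
  g′ (suc v) = g (suc v)
  split : ∀ v → g v ≡ atN (just zero) v ℕ.+ g′ v
  split zero    = g₀
  split (suc v) = refl
... | zero with take-unit (g ∘ suc) eq
...   | a , g″ , split″ , sum″ = suc a , g′ , split , sum″
  where
  g′ : Fin (suc n) → ℕ
  g′ zero    = 0
  g′ (suc v) = g″ v
  split : ∀ v → g v ≡ atN (just (suc a)) v ℕ.+ g′ v
  split zero    = g₀
  split (suc v) = trans (split″ v) (cong (ℕ._+ g″ v) (sym (atN-suc a v)))

Completion : ∀ {k} → Graph k → ℕ → Set
Completion K n = Σ (Graph n) λ H → Cubic H × Embedding K H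

-- `g` records the deficiency of each vertex. Every new edge uses up two units, at vertices that may
-- coincide, since loops are allowed; thus `d` edges suffice.
complete-even : ∀ {k} d (K : Graph k) (g : Fin k → ℕ) → Closed K → (∀ v → deg K v ℕ.+ g v ≡ 3) →
  ℕSum.sum g ≡ d ℕ.* 2 → Completion K k
complete-even zero K g cl def eq = K , (cl , λ v → trans (sym (ℕ.+-identityʳ _)) (trans (cong (deg K v ℕ.+_) (sym (g-zero g eq v))) (def v))) ,
  record { φV = id ; φE = id ; injV = id ; injE = id ; pres = λ e → inj₁ λ i → sym (MaybeP.map-id (ends K e i)) }
  where
  g-zero : ∀ {n} (g : Fin n → ℕ) → ℕSum.sum g ≡ 0 → ∀ v → g v ≡ 0
  g-zero g eq zero    = ℕ.m+n≡0⇒m≡0 (g zero) eq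
  g-zero g eq (suc v) = g-zero (g ∘ suc) (ℕ.m+n≡0⇒n≡0 (g zero) eq) v
complete-even (suc d) K g cl def eq with take-unit g eq
... | a , g₁ , split₁ , sum₁ with take-unit g₁ sum₁
... | b , g₂ , split₂ , sum₂ = drop-edge (complete-even d (addEdge K a b) g₂ cl′ def′ sum₂)
  where
  drop-edge : Completion (addEdge K a b) _ → Completion K _
  drop-edge (H , cubicH , ψ) = H , cubicH ,
    record { φV = φV ψ ; φE = φE ψ ∘ suc ; injV = injV ψ ; injE = suc-injective ∘ injE ψ ; pres = pres ψ ∘ suc }
  cl′ : Closed (addEdge K a b)
  cl′ zero    zero       ()
  cl′ zero    (suc zero) ()
  cl′ (suc e) i          = cl e i
  def′ : ∀ v → deg (addEdge K a b) v ℕ.+ g₂ v ≡ 3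
  def′ v = trans (cong (ℕ._+ g₂ v) (addEdge-deg K a b v)) (trans (shuffle (atN (just a) v) (atN (just b) v) (deg K v) (g₂ v))
    (trans (cong (deg K v ℕ.+_) (sym (trans (split₁ v) (cong (atN (just a) v ℕ.+_) (split₂ v))))) (def v)))
    where
    shuffle : ∀ x y z w → x ℕ.+ (y ℕ.+ 0) ℕ.+ z ℕ.+ w ≡ z ℕ.+ (x ℕ.+ (y ℕ.+ w))
    shuffle = ℕSolver.solve-∀

half : ∀ s → ∃[ d ] (s ≡ d ℕ.* 2 ⊎ s ≡ suc (d ℕ.* 2))
half zero    = 0 , inj₁ refl
half (suc s) with half s
... | d , inj₁ refl = d , inj₂ refl
... | d , inj₂ refl = suc d , inj₁ refl

completion : ∀ {k} (K : Graph k) → Closed K → (∀ v → deg K v ≤ 3) → ∃[ n ] n ≤ suc k × Completion K n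
completion {k} K cl le with half (ℕSum.sum λ v → 3 ℕ.∸ deg K v)
... | d , inj₁ eq = k , ℕ.n≤1+n k , complete-even d K _ cl (λ v → ℕ.m+[n∸m]≡n (le v)) eq
-- A new isolated vertex has deficiency 3 and corrects the parity: 3 + (2d + 1) = 2(d + 2).
... | d , inj₂ eq = suc k , ℕ.≤-refl , drop-vertex (complete-even (suc (suc d)) (isolate K) g cl′ def (cong (3 ℕ.+_) eq))
  where
  g : Fin (suc k) → ℕ
  g zero    = 3
  g (suc v) = 3 ℕ.∸ deg K v
  cl′ : Closed (isolate K)
  cl′ e i p with ends K e i in q
  ... | nothing = cl e i q
  def : ∀ v → deg (isolate K) v ℕ.+ g v ≡ 3
  def zero    = cong (ℕ._+ 3) (isolate-deg-zero K)
  def (suc v) = trans (cong (ℕ._+ g (suc v)) (isolate-deg-suc K v)) (ℕ.m+[n∸m]≡n (le v))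
  drop-vertex : Completion (isolate K) (suc k) → Completion K (suc k)
  drop-vertex (H , cubicH , ψ) = H , cubicH , record
    { φV = φV ψ ∘ suc ; φE = φE ψ ; injV = suc-injective ∘ injV ψ ; injE = injE ψ
    ; pres = λ e → [ (λ p → inj₁ λ i → trans (p i) (through (ends K e i)))
                   , (λ p → inj₂ λ i → trans (p i) (through (ends K e (opposite i)))) ] (pres ψ e) }
    where
    through : ∀ m → Maybe.map (φV ψ) (m >>= (just ∘ suc)) ≡ Maybe.map (φV ψ ∘ suc) m
    through nothing  = refl
    through (just w) = refl

-- Finite searches

-- Presents a decidable subset as some `Fin size`, which supplies the vertex and edge sets of
-- components.
record Enumeration {n} (P : Fin n → Set) : Set where
  field
    size           : ℕ
    elem           : Fin size → Fin n
    elem-injective : ∀ {i j} → elem i ≡ elem j → i ≡ j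
    sound          : ∀ i → P (elem i)
    index          : ∀ {x} → P x → ∃[ i ] elem i ≡ x

enumerate : ∀ {n} {P : Fin n → Set} → (∀ x → Dec (P x)) → Enumeration P
enumerate {zero} P? = record { size = 0 ; elem = λ () ; elem-injective = λ { {()} } ; sound = λ () ; index = λ { {()} } }
enumerate {suc n} {P} P? with enumerate (P? ∘ suc) | P? zero
... | E | no ¬p = record
  { size = E.size ; elem = suc ∘ E.elem ; elem-injective = E.elem-injective ∘ suc-injective ; sound = E.sound
  ; index = λ { {zero} p → contradiction p ¬p ; {suc x} p → let i , eq = E.index p in i , cong suc eq } }
  where module E = Enumeration E
... | E | yes p₀ = record
  { size = suc E.size ; elem = elem ; elem-injective = inj ; sound = λ { zero → p₀ ; (suc i) → E.sound i }
  ; index = λ { {zero} p → zero , refl ; {suc x} p → let i , eq = E.index p in suc i , cong suc eq } }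
  where
  module E = Enumeration E
  elem : Fin (suc E.size) → Fin (suc n)
  elem zero    = zero
  elem (suc i) = suc (E.elem i)
  inj : ∀ {i j} → elem i ≡ elem j → i ≡ j
  inj {zero}  {zero}  _  = refl
  inj {suc i} {suc j} eq = cong suc (E.elem-injective (suc-injective eq))

find : ∀ {n} → (Fin n → Bool) → Maybe (Fin n)
find {zero}  b = nothing
find {suc n} b = if b zero then just zero else Maybe.map suc (find (b ∘ suc))

find-cong : ∀ {n} {b b′ : Fin n → Bool} → (∀ x → b x ≡ b′ x) → find b ≡ find b′
find-cong {zero}  eq = refl
find-cong {suc n} eq = cong₂ (λ p q → if p then just zero else Maybe.map suc q) (eq zero) (find-cong (eq ∘ suc))

find-just : ∀ {n} (b : Fin n → Bool) {x} → b x ≡ true → ∃[ y ] find b ≡ just y × b y ≡ true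
find-just {suc n} b {x} p with b zero in b₀
... | true  = zero , refl , b₀
find-just {suc n} b {zero}  p | false = contradiction (trans (sym b₀) p) λ ()
find-just {suc n} b {suc x} p | false with find-just (b ∘ suc) p
... | y , q , r = suc y , cong (Maybe.map suc) q , r

-- Double-negation shift, valid over a finite range. It permits classical assumptions about all
-- vertices at once when the goal is stable.
¬¬-∀ : ∀ {n} {P : Fin n → Set} → (∀ x → ¬ ¬ P x) → ¬ ¬ (∀ x → P x)
¬¬-∀ {zero}  p k = k λ ()
¬¬-∀ {suc n} p k = p zero λ p₀ → ¬¬-∀ (p ∘ suc) λ ps → k λ { zero → p₀ ; (suc x) → ps x }

-- The search fixes one value at a time. Invariance of `P` under pointwise equality takes the place
-- of function extensionality.
∃-function? : ∀ m {k} {P : (Fin m → Fin k) → Set} → (∀ {f g} → (∀ x → f x ≡ g x) → P f → P g) →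
  (∀ f → Dec (P f)) → Dec (∃ P)
∃-function? zero {k} resp P? = map′ (λ p → none , p) (λ (f , p) → resp {f} {none} (λ ()) p) (P? none)
  where
  none : Fin 0 → Fin k
  none ()
∃-function? (suc m) {k} {P} resp P? = map′ (λ (a , f , p) → a ▸ f , p)
  (λ (f , p) → f zero , f ∘ suc , resp {f} {f zero ▸ (f ∘ suc)} (λ { zero → refl ; (suc x) → refl }) p)
  (any? λ a → ∃-function? m {P = λ f → P (a ▸ f)} (λ {f} {g} eq → resp {a ▸ f} {a ▸ g} λ { zero → refl ; (suc x) → eq x }) λ f → P? (a ▸ f))
  where
  _▸_ : Fin k → (Fin m → Fin k) → Fin (suc m) → Fin k
  (a ▸ f) zero    = a
  (a ▸ f) (suc x) = f x

colourable? : ∀ {n} (G : Graph n) → Dec (Colourable3 G)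
colourable? G = ∃-function? (nE G)
  (λ eq pr e e′ i i′ v p q ne ce → pr e e′ i i′ v p q ne (trans (eq e) (trans ce (sym (eq e′)))))
  λ c → all? λ e → all? λ e′ → all? λ i → all? λ i′ → all? λ v →
    at? G (e , i) v →-dec at? G (e′ , i′) v →-dec ¬? ((e , i) ≟ₑ (e′ , i′)) →-dec ¬? (c e ≟ c e′)

∣⁅x⁆∪p∣≤ : ∀ {m} (x : Fin m) p → ∣ ⁅ x ⁆ ∪ p ∣ ≤ suc ∣ p ∣
∣⁅x⁆∪p∣≤ zero    (s ∷ p) rewrite ∪-identityˡ p = s≤s (∣p∣≤∣x∷p∣ s p)
∣⁅x⁆∪p∣≤ (suc x) (inside ∷ p)  = s≤s (∣⁅x⁆∪p∣≤ x p)
∣⁅x⁆∪p∣≤ (suc x) (outside ∷ p) = ∣⁅x⁆∪p∣≤ x p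

abstract
  edgeSet : ∀ {m} → List (Fin m) → Subset m
  edgeSet = foldr (λ e S → ⁅ e ⁆ ∪ S) ∅

  edgeSet-size : ∀ {m} (es : List (Fin m)) → ∣ edgeSet es ∣ ≤ length es
  edgeSet-size {m} []   = ℕ.≤-reflexive (∣⊥∣≡0 m)
  edgeSet-size (e ∷ es) = ℕ.≤-trans (∣⁅x⁆∪p∣≤ e (edgeSet es)) (s≤s (edgeSet-size es))

  ∈-edgeSet⁺ : ∀ {m} {es : List (Fin m)} {e} → e ∈ˡ es → e ∈ edgeSet es
  ∈-edgeSet⁺ {e = e} (here refl) = x∈p∪q⁺ (inj₁ (x∈⁅x⁆ e))
  ∈-edgeSet⁺ (there p)           = x∈p∪q⁺ (inj₂ (∈-edgeSet⁺ p))

  ∈-edgeSet⁻ : ∀ {m} (es : List (Fin m)) {e} → e ∈ edgeSet es → e ∈ˡ es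
  ∈-edgeSet⁻ []       p = contradiction p ∉⊥
  ∈-edgeSet⁻ (f ∷ es) p with x∈p∪q⁻ ⁅ f ⁆ (edgeSet es) p
  ... | inj₁ q = here (x∈⁅y⁆⇒x≡y f q)
  ... | inj₂ q = there (∈-edgeSet⁻ es q)

-- Greedy extension of colourings

third : ∀ (a b : Fin 3) → ∃[ t ] t ≢ a × t ≢ b
third zero             zero             = suc zero , (λ ()) , λ ()
third zero             (suc zero)       = suc (suc zero) , (λ ()) , λ ()
third zero             (suc (suc zero)) = suc zero , (λ ()) , λ ()
third (suc zero)       zero             = suc (suc zero) , (λ ()) , λ ()
third (suc zero)       (suc b)          = zero , (λ ()) , λ ()
third (suc (suc zero)) zero             = suc zero , (λ ()) , λ ()
third (suc (suc zero)) (suc b)          = zero , (λ ()) , λ ()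

module _ {n} (G : Graph n) (cubic : Cubic G) (P : Fin n → Set) where

  ProperExcept : List (Fin (nE G)) → (Fin (nE G) → Fin 3) → Set
  ProperExcept es c = ∀ h k w → P w → At G h w → At G k w → proj₁ h ∉ˡ es → proj₁ k ∉ˡ es →
    h ≢ k → c (proj₁ h) ≢ c (proj₁ k)

  HalfOff : Fin (nE G) → Set
  HalfOff e = ∃[ i ] ∃[ w ] At G (e , i) w × ¬ P w

  private
    add-edge : ∀ {e es c} → HalfOff e → ProperExcept (e ∷ es) c → ∃[ c′ ] ProperExcept es c′
    add-edge {e} {es} {c} (i , w₀ , e-at , w₀∉) pr with endV G (proj₁ cubic) e (opposite i)
    ... | w , f-at with tripleAt G (proj₂ cubic) (e , opposite i) f-at
    ... | k₁ , k₂ , t with third (c (proj₁ k₁)) (c (proj₁ k₂))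
    ... | s , s≢₁ , s≢₂ = c′ , proper
      where
      c′ = c [ e ↦ s ]
      only : ∀ {j x} → P x → At G (e , j) x → j ≡ opposite i
      only {j} Px p = ≢⇒opp {i} λ { refl → w₀∉ (subst P (At-unique G (e , i) p e-at) Px) }
      fresh : ∀ j k x → P x → At G (e , j) x → At G k x → proj₁ k ≢ e → s ≢ c (proj₁ k)
      fresh j k x Px p q k≢e with only Px p
      ... | refl with At-unique G (e , opposite i) p f-at
      ... | refl with Triple.exhaust t k q
      ...   | inj₁ refl        = contradiction refl k≢e
      ...   | inj₂ (inj₁ refl) = s≢₁
      ...   | inj₂ (inj₂ refl) = s≢₂
      skip : ∀ {f} → f ≢ e → f ∉ˡ es → f ∉ˡ (e ∷ es)
      skip f≢e f∉ (here eq) = f≢e eq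
      skip f≢e f∉ (there q) = f∉ q
      proper : ProperExcept es c′
      proper (f , j) (g , l) x Px p q f∉ g∉ ne with f ≟ e | g ≟ e
      ... | yes refl | yes refl = contradiction (cong (e ,_) (trans (only Px p) (sym (only Px q)))) ne
      ... | yes refl | no g≢e   = fresh j (g , l) x Px p q g≢e
      ... | no f≢e   | yes refl = fresh l (f , j) x Px q p f≢e ∘ sym
      ... | no f≢e   | no g≢e   = pr (f , j) (g , l) x Px p q (skip f≢e f∉) (skip g≢e g∉) ne

  -- An edge with only one end in P meets at most two other edges there, hence colours extend greedily.
  extend-colouring : ∀ {es c} → All HalfOff es → ProperExcept es c → ∃[ c′ ] ProperOn G P c′
  extend-colouring {c = c} [] pr = c , λ h k w Pw p q → pr h k w Pw p q (λ ()) (λ ())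
  extend-colouring (ho ∷ hos) pr = extend-colouring hos (proj₂ (add-edge ho pr))

-- Components after removal of an edge set

ProperAvoiding : ∀ {n} (G : Graph n) → Subset (nE G) → (Fin n → Set) → (Fin (nE G) → Fin 3) → Set
ProperAvoiding G S P c = ∀ h k w → P w → At G h w → At G k w → proj₁ h ∉ S → proj₁ k ∉ S → h ≢ k →
  c (proj₁ h) ≢ c (proj₁ k)

module _ {n} (G : Graph n) (S : Subset (nE G)) where

  Link : Fin n → Fin n → Set
  Link x y = ∃[ h ] proj₁ h ∉ S × At G h x × At G (flip {G = G} h) y

  link-sym : ∀ {x y} → Link x y → Link y x
  link-sym (h , h∉ , p , q) = flip {G = G} h , h∉ , q , subst (λ k → At G k _) (sym (flip-flip {G = G} h)) p

  Reach : Fin n → Fin n → Set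
  Reach = Star Link

  reach-sym : ∀ {x y} → Reach x y → Reach y x
  reach-sym = reverse link-sym

  module _ (cl : Closed G) where

    reach-ends : ∀ {e} → e ∉ S → ∀ i j {x y} → At G (e , i) x → At G (e , j) y → Reach x y
    reach-ends {e} e∉ i j {x} {y} p q with i ≟ j
    ... | yes refl = subst (Reach x) (At-unique G (e , i) p q) ε
    ... | no i≢j   = ((e , i) , e∉ , p , subst (λ k → At G (e , k) y) (≢⇒opp i≢j) q) ◅ ε

    -- Decidable reachability is what allows the component of `r` to be enumerated as a graph; it is
    -- assumed here and supplied under a double negation at the end.
    module Component (r : Fin n) (R? : ∀ w → Dec (Reach r w)) where

      private
        vert : Fin (nE G) → Fin 2 → Fin n
        vert e i = proj₁ (endV G cl e i)
        vert-at : ∀ e i → At G (e , i) (vert e i)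
        vert-at e i = proj₂ (endV G cl e i)

        Inner : Fin (nE G) → Set
        -- Testing one end suffices, because the ends of an edge outside `S` reach each other.
        Inner e = e ∉ S × Reach r (vert e zero)

        inner? : ∀ e → Dec (Inner e)
        inner? e = ¬? (e ∈? S) ×-dec R? (vert e zero)

        inner : ∀ {e i w} → e ∉ S → At G (e , i) w → Reach r w → Inner e
        inner {e} {i} e∉ p Rw = e∉ , Rw ◅◅ reach-ends e∉ i zero p (vert-at e zero)

        inner-end : ∀ {e} → Inner e → ∀ i → Reach r (vert e i)
        inner-end {e} (e∉ , Re) i = Re ◅◅ reach-ends e∉ zero i (vert-at e zero) (vert-at e i)

        module V = Enumeration (enumerate R?)
        module E = Enumeration (enumerate inner?)

        end : ∀ e i → ∃[ w ] V.elem w ≡ vert (E.elem e) i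
        end e i = V.index (inner-end (E.sound e) i)

      graph : Graph V.size
      graph = record { nE = E.size ; ends = λ e i → just (proj₁ (end e i)) }

      private
        at⁺ : ∀ h {w} → At G (E.elem (proj₁ h) , proj₂ h) (V.elem w) → At graph h w
        at⁺ (e , i) {w} p = cong just (V.elem-injective
          (trans (proj₂ (end e i)) (At-unique G (E.elem e , i) (vert-at (E.elem e) i) p)))

      embedding : Embedding graph G
      embedding = record
        { φV = V.elem ; φE = E.elem ; injV = V.elem-injective ; injE = E.elem-injective
        ; pres = λ e → inj₁ λ i → trans (vert-at (E.elem e) i) (cong just (sym (proj₂ (end e i)))) }

      vertex-reached : ∀ w → Reach r (φV embedding w)
      vertex-reached = V.sound

      closed : Closed graph
      closed e i ()

      private
        lift-link : ∀ {p q} → Link (V.elem p) (V.elem q) → Adj graph p q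
        lift-link {p} ((e , i) , e∉ , x , y) with E.index (inner e∉ x (V.sound p))
        ... | e′ , refl = adj graph (e′ , i) (at⁺ (e′ , i) x) (at⁺ (e′ , opposite i) y)

        lift-reach : ∀ {x y} → Reach x y → ∀ {p q} → V.elem p ≡ x → V.elem q ≡ y → Star (Adj graph) p q
        lift-reach ε {p} refl eq = subst (Star (Adj graph) p) (V.elem-injective (sym eq)) ε
        lift-reach (l ◅ ls) {p} refl eq with V.index (V.sound p ◅◅ l ◅ ε)
        ... | p₁ , refl = lift-link l ◅ lift-reach ls refl eq

      connected : Connected graph
      connected p q = lift-reach (reach-sym (V.sound p) ◅◅ V.sound q) refl refl

      isComponent : IsComponentMinus G S graph
      isComponent = embedding , connected , (λ e → proj₁ (E.sound e)) ,
        λ e i w e∉ p → E.index (inner e∉ p (V.sound w))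

      colouring : Colourable3 graph → ∃ (ProperAvoiding G S (Reach r))
      colouring (c₀ , pr) = c , proper
        where
        cᵈ : ∀ e → Dec (Inner e) → Fin 3
        cᵈ e (yes p) = c₀ (proj₁ (E.index p))
        -- An arbitrary colour: such an edge lies in `S` or meets no vertex reachable from `r`.
        cᵈ e (no _)  = zero
        c : Fin (nE G) → Fin 3
        c e = cᵈ e (inner? e)
        c-elem : ∀ e → c (E.elem e) ≡ c₀ e
        c-elem e with inner? (E.elem e)
        ... | yes p = cong c₀ (E.elem-injective (proj₂ (E.index p)))
        ... | no ¬p = contradiction (E.sound e) ¬p
        proper : ProperAvoiding G S (Reach r) c
        proper (e , i) (f , j) w Rw p q e∉ f∉ ne cc
          with E.index (inner e∉ p Rw) | E.index (inner f∉ q Rw) | V.index Rw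
        ... | e′ , refl | f′ , refl | w′ , refl = pr e′ f′ i j w′ (at⁺ (e′ , i) p) (at⁺ (f′ , j) q)
          (λ { refl → ne refl }) (trans (sym (c-elem e′)) (trans cc (c-elem f′)))

    -- Colourings of the components are glued by choosing one representative in each component.
    module Glue (R? : ∀ x y → Dec (Reach x y)) where

      rep : Fin n → Fin n
      -- The first vertex reachable from `w`. The default is never taken, as `w` reaches itself.
      rep w = fromMaybe w (find (does ∘ R? w))

      reach-rep : ∀ w → Reach w (rep w)
      reach-rep w with find-just (does ∘ R? w) (dec-true (R? w w) ε)
      ... | y , eq , q = subst (Reach w) (sym (cong (fromMaybe w) eq)) (witness (R? w y) q)
        where
        witness : ∀ {A : Set} (d : Dec A) → does d ≡ true → A
        witness (yes a) _ = a

      -- Both vertices reach exactly the same vertices, and `find` depends only on the truth values.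
      rep-cong : ∀ {w w′} → Reach w w′ → rep w ≡ rep w′
      rep-cong {w} {w′} ww′ with find-just (does ∘ R? w) (dec-true (R? w w) ε)
      ... | y , eq , _ = trans (cong (fromMaybe w) eq) (sym (cong (fromMaybe w′) (trans (sym (find-cong agree)) eq)))
        where
        agree : ∀ x → does (R? w x) ≡ does (R? w′ x)
        agree x with R? w x
        ... | yes wx = sym (dec-true (R? w′ x) (reach-sym ww′ ◅◅ wx))
        ... | no ¬wx = sym (dec-false (R? w′ x) λ w′x → ¬wx (ww′ ◅◅ w′x))

      -- `local` yields a colouring for every `r`, and only its properness presupposes `P r`; so
      -- each edge can take its colour from the colouring at its own representative.
      glue : ∀ {P : Fin n → Set} → (∀ {x y} → Reach x y → P x → P y) →
        (∀ r → ∃ λ c → P r → ProperAvoiding G S (Reach r) c) → ∃ (ProperAvoiding G S P)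
      glue {P} P-closed local = c , proper
        where
        root : Fin (nE G) → Fin n
        root e = rep (proj₁ (endV G cl e zero))
        c : Fin (nE G) → Fin 3
        c e = proj₁ (local (root e)) e
        root-at : ∀ {e i w} → e ∉ S → At G (e , i) w → root e ≡ rep w
        root-at {e} {i} e∉ p = rep-cong (reach-ends e∉ zero i (proj₂ (endV G cl e zero)) p)
        proper : ProperAvoiding G S P c
        proper h k w Pw p q h∉ k∉ ne cc = proj₂ (local (rep w)) (P-closed (reach-rep w) Pw) h k w (reach-sym (reach-rep w)) p q h∉ k∉ ne
          (trans (sym (cong (λ x → proj₁ (local x) (proj₁ h)) (root-at h∉ p)))
            (trans cc (cong (λ x → proj₁ (local x) (proj₁ k)) (root-at k∉ q))))

-- From 5-irreducibility to criticality

off? : ∀ {n} (u v w : Fin n) → Dec (Off u v w)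
off? u v w = ¬? (w ≟ u) ×-dec ¬? (w ≟ v)

-- Cutting the edges adjacent to uv separates u and v from the remaining vertices.
module Cut {n} (G : Graph n) (cubic : Cubic G) {u v} (u≢v : u ≢ v) {h₀ a b c d : End G}
           (tu : Triple G u h₀ a b) (tv : Triple G v (flip {G = G} h₀) c d) (irr : Irreducible 5 G) where

  private
    module U = Triple tu
    module V = Triple tv

    cut : List (Fin (nE G))
    -- Entries may coincide, through an edge parallel to uv or a loop, so four is an upper bound for
    -- the number of removed edges.
    cut = proj₁ a ∷ proj₁ b ∷ proj₁ c ∷ proj₁ d ∷ []

    S : Subset (nE G)
    S = edgeSet cut

    half-off : All (HalfOff G cubic (Off u v)) cut
    half-off = (proj₂ a , u , U.at₁ , λ o → proj₁ o refl) ∷ (proj₂ b , u , U.at₂ , λ o → proj₁ o refl)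
             ∷ (proj₂ c , v , V.at₁ , λ o → proj₂ o refl) ∷ (proj₂ d , v , V.at₂ , λ o → proj₂ o refl) ∷ []

    uncut-u : ∀ k → proj₁ k ∉ S → At G k u → k ≡ h₀
    uncut-u k k∉ p with U.exhaust k p
    ... | inj₁ eq        = eq
    ... | inj₂ (inj₁ eq) = contradiction (∈-edgeSet⁺ (here (cong proj₁ eq))) k∉
    ... | inj₂ (inj₂ eq) = contradiction (∈-edgeSet⁺ (there (here (cong proj₁ eq)))) k∉

    uncut-v : ∀ k → proj₁ k ∉ S → At G k v → k ≡ flip {G = G} h₀
    uncut-v k k∉ p with V.exhaust k p
    ... | inj₁ eq        = eq
    ... | inj₂ (inj₁ eq) = contradiction (∈-edgeSet⁺ (there (there (here (cong proj₁ eq))))) k∉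
    ... | inj₂ (inj₂ eq) = contradiction (∈-edgeSet⁺ (there (there (there (here (cong proj₁ eq)))))) k∉

    -- The only uncut end at `u` is `h₀`, and the only one at `v` is its opposite; hence a link into
    -- one of these vertices starts at the other.
    off-link : ∀ {x y} → Link G S x y → Off u v x → Off u v y
    off-link (k , k∉ , p , q) (x≢u , x≢v) =
      (λ { refl → x≢v (At-unique G k p (subst (λ g → At G g v) (unflip (uncut-u _ k∉ q)) V.at₀)) }) ,
      (λ { refl → x≢u (At-unique G k p (subst (λ g → At G g u) (unflip′ (uncut-v _ k∉ q)) U.at₀)) })
      where
      unflip : flip {G = G} k ≡ h₀ → flip {G = G} h₀ ≡ k
      unflip eq = trans (cong (flip {G = G}) (sym eq)) (flip-flip {G = G} k)
      unflip′ : flip {G = G} k ≡ flip {G = G} h₀ → h₀ ≡ k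
      unflip′ eq = trans (sym (flip-flip {G = G} h₀)) (trans (cong (flip {G = G}) (sym eq)) (flip-flip {G = G} k))

    off-reach : ∀ {x y} → Reach G S x y → Off u v x → Off u v y
    off-reach ε        o = o
    off-reach (l ◅ ls) o = off-reach ls (off-link l o)

    module _ (R? : ∀ x y → Dec (Reach G S x y)) where

      module C (r : Fin n) = Component G S (proj₁ cubic) r (R? r)

      component-small : ∀ {j} {K : Graph j} (φ : Embedding K G) → (∀ w → Off u v (φV φ w)) → suc (suc j) ≤ n
      component-small {j} φ o = injective⇒≤ {f = f} f-injective
        where
        f : Fin (suc (suc j)) → Fin n
        f zero          = u
        f (suc zero)    = v
        f (suc (suc w)) = φV φ w
        f-injective : ∀ {x y} → f x ≡ f y → x ≡ y
        f-injective {zero}        {zero}        _  = refl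
        f-injective {zero}        {suc zero}    eq = contradiction eq u≢v
        f-injective {zero}        {suc (suc y)} eq = contradiction (sym eq) (proj₁ (o y))
        f-injective {suc zero}    {zero}        eq = contradiction (sym eq) u≢v
        f-injective {suc zero}    {suc zero}    _  = refl
        f-injective {suc zero}    {suc (suc y)} eq = contradiction (sym eq) (proj₂ (o y))
        f-injective {suc (suc x)} {zero}        eq = contradiction eq (proj₁ (o x))
        f-injective {suc (suc x)} {suc zero}    eq = contradiction eq (proj₂ (o x))
        f-injective {suc (suc x)} {suc (suc y)} eq = cong (λ w → suc (suc w)) (injV φ eq)

      -- A completion has at most one vertex more than the component, which omits both `u` and `v`,
      -- so it is smaller than `G`. Irreducibility only refutes non-colourability, whence the double
      -- negation.
      component-colourable : ∀ r → Off u v r → ¬ ¬ Colourable3 (C.graph r)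
      component-colourable r o uncol = reduce (completion (C.graph r) (C.closed r)
        λ w → subst (deg (C.graph r) w ≤_) (proj₂ cubic _) (Embedded.degree-≤ (C.embedding r) w))
        where
        reduce : (∃[ m ] m ≤ suc _ × Completion (C.graph r) m) → ⊥
        reduce (m , m≤ , H , cubicH , ψ) = irr S (s≤s (edgeSet-size cut)) (C.graph r) (C.isComponent r) uncol
          (m , H , cubicH , ℕ.≤-<-trans m≤ (component-small (C.embedding r) (λ w → off-reach (C.vertex-reached r w) o)) , ψ)

      colour-off : (∀ r → Off u v r → Colourable3 (C.graph r)) → ∃[ c ] ProperOn G (Off u v) c
      colour-off cols = extend-colouring G cubic (Off u v) half-off λ h k w o p q h∉ k∉ →
          proj₂ glued h k w o p q (h∉ ∘ ∈-edgeSet⁻ cut) (k∉ ∘ ∈-edgeSet⁻ cut)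
        where
        glued = Glue.glue G S (proj₁ cubic) R? {P = Off u v} off-reach local
          where
          local : ∀ r → ∃ λ c → Off u v r → ProperAvoiding G S (Reach G S r) c
          local r with off? u v r
          ... | yes o = let c , pr = C.colouring r (cols r o) in c , λ _ → pr
          ... | no ¬o = (λ _ → zero) , λ o → contradiction o ¬o

  -- Colourability is decidable, so reachability may be assumed decidable as well.
  pair-colourable : Colourable3 (deletePair G u v u≢v)
  pair-colourable = decidable-stable (colourable? (deletePair G u v u≢v)) λ uncol →
    ¬¬-∀ (λ x → ¬¬-∀ {P = λ y → Dec (Reach G S x y)} λ y → ¬¬-excluded-middle) λ R? →
    ¬¬-∀ {P = λ r → Off u v r → Colourable3 (C.graph R? r)}
      (λ r no-col → no-col λ o → ⊥-elim (component-colourable R? r o λ col → no-col λ _ → col)) λ cols →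
    uncol (deletePair⁺ G u v u≢v (proj₂ (colour-off R? cols)))

irreducible⇒critical : ∀ {n} (G : Graph n) → Cubic G → Irreducible 5 G → Critical G
irreducible⇒critical G cubic irr u v u≢v a with adj⁻ G a
... | h₀ , p , q = Cut.pair-colourable G cubic u≢v (proj₂ (proj₂ (tripleAt G (proj₂ cubic) h₀ p)))
                     (proj₂ (proj₂ (tripleAt G (proj₂ cubic) (flip {G = G} h₀) q))) irr

theorem4 : ∀ {n : ℕ} (G : Graph n) → Snark G →
    (Critical G ⇔ FourEdgeCritical G)
    × (Critical G ⇔ Irreducible 5 G)
    × (Critical G ⇔ Irreducible 6 G)
    × (Critical G ⇔ SmoothColourable G)
theorem4 G (conn , cubic , uncol) =
    mk⇔ (critical⇒flow G cubic) (flow⇒critical G cubic)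
  , mk⇔ (irreducible-mono G 5≤6 ∘ critical⇒irreducible G conn cubic) (irreducible⇒critical G cubic)
  , mk⇔ (critical⇒irreducible G conn cubic) (irreducible⇒critical G cubic ∘ irreducible-mono G 5≤6)
  , mk⇔ (critical⇒smooth G cubic uncol) (smooth⇒critical G cubic)
  where
  5≤6 : 5 ≤ 6
  5≤6 = ℕ.n≤1+n 5
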